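{- Suppose $f\colon \mathbb{N} \to [0,\infty)$ is a sub-identical order function such that $\sum_{m=0}^\infty f(2^m)/2^m$ converges. Then for every rational $\delta \in (0,1]$, $\mathrm{SC}(f) \leq_{\mathrm{s}} \mathrm{COMPLEX}(\delta)$.
   Context: An order function is a computable (i.e. its values are uniformly computable reals), nondecreasing, unbounded function $\mathbb{N}\to\mathbb{R}$. A function $f\colon\mathbb{N}\to[0,\infty)$ is sub-identical if $\lim_{n\to\infty}(n-f(n))=\infty$. Prefix-free complexity: a prefix-free machine is a partial recursive $M$ from $\{0,1\}^*$ to $\{0,1\}^*$ with prefix-free domain; $U$ is universal if for each prefix-free machine $M$ there is $\rho$ with $U(\rho^\frown\tau)\simeq M(\tau)$ for all $\tau$. Fix a universal $U$ and let $K(\sigma)=\min\{|\tau| : U(\tau)=\sigma\}$. For $\delta\in(0,1]$, $\mathrm{COMPLEX}(\delta)$ is the set of $X\in\{0,1\}^{\mathbb{N}}$ for which there is $c\in\mathbb{N}$ with $K(X\upharpoonright n)\geq \delta n-c$ for all $n$. $\mathrm{SC}(f)$ is the set of $X\in\{0,1\}^{\mathbb{N}}$ for which there is $c\in\mathbb{N}$ with $K(\tau)\geq f(|\tau|)-c$ for every (contiguous, finite) substring $\tau$ of $X$. For $P,Q\subseteq\mathbb{N}^{\mathbb{N}}$, $P\leq_{\mathrm{s}}Q$ means there is a partial recursive functional defined on all of $Q$ that maps $Q$ into $P$. -}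

module Defs where

open import Data.Bool using (Bool; true; false; if_then_else_)
open import Data.Empty using (⊥)
open import Data.Fin using (Fin)
open import Data.Integer using (+_; _⊖_)
open import Data.List using (List; []; _∷_; _++_; length; applyUpTo)
open import Data.List.Relation.Binary.Prefix.Heterogeneous using (Prefix)
open import Data.Nat as ℕ using (ℕ; zero; suc; _^_)
import Data.Nat.Properties as ℕₚ
open import Data.Product using (∃-syntax; _×_; _,_)
open import Data.Rational as ℚ using (ℚ; 0ℚ; 1ℚ; ½)
import Data.Rational.Properties as ℚₚ
open import Data.Rational.Solver using (module +-*-Solver)
open import Data.Unit using (⊤)
open import Data.Vec using (Vec; []; _∷_; lookup)
open import Level using (0ℓ)
open import Relation.Binary.PropositionalEquality
  using (_≡_; refl; sym; trans; cong; subst)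
open import Relation.Nullary using (¬_)
open import Relation.Unary using (Pred)

------------------------------------------------------------------------
-- Real numbers: Cauchy sequences of rationals.  Two sequences represent
-- the same real when _≤ᵣ_ holds in both directions.

Cauchy : (ℕ → ℚ) → Set
Cauchy x = ∀ ε → 0ℚ ℚ.< ε →
  ∃[ N ] (∀ m n → N ℕ.≤ m → N ℕ.≤ n → ℚ.∣ x m ℚ.- x n ∣ ℚ.≤ ε)

record ℝ : Set where
  constructor mkℝ
  field
    approx : ℕ → ℚ
    cauchy : Cauchy approx

open ℝ public

private
  half : ∀ {ε} → 0ℚ ℚ.< ε → 0ℚ ℚ.< ½ ℚ.* ε
  half {ε} 0<ε = subst (ℚ._< ½ ℚ.* ε) (ℚₚ.*-zeroʳ ½) (ℚₚ.*-monoʳ-<-pos ½ 0<ε)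

  half+half : ∀ ε → ½ ℚ.* ε ℚ.+ ½ ℚ.* ε ≡ ε
  half+half ε = trans (sym (ℚₚ.*-distribʳ-+ ε ½ ½)) (ℚₚ.*-identityˡ ε)

  const-cauchy : ∀ q → Cauchy (λ _ → q)
  const-cauchy q ε 0<ε = 0 , λ _ _ _ _ →
    subst (λ r → ℚ.∣ r ∣ ℚ.≤ ε) (sym (ℚₚ.+-inverseʳ q)) (ℚₚ.<⇒≤ 0<ε)

  +-cauchy : ∀ x y → Cauchy x → Cauchy y → Cauchy (λ n → x n ℚ.+ y n)
  +-cauchy x y cx cy ε 0<ε =
    let (M , px) = cx (½ ℚ.* ε) (half 0<ε)
        (N , py) = cy (½ ℚ.* ε) (half 0<ε)
    in M ℕ.⊔ N , λ m n p q → begin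
      ℚ.∣ (x m ℚ.+ y m) ℚ.- (x n ℚ.+ y n) ∣
        ≡⟨ cong ℚ.∣_∣ (solve 4 (λ a b c d → (a :+ b) :- (c :+ d) := (a :- c) :+ (b :- d))
                       refl (x m) (y m) (x n) (y n)) ⟩
      ℚ.∣ (x m ℚ.- x n) ℚ.+ (y m ℚ.- y n) ∣
        ≤⟨ ℚₚ.∣p+q∣≤∣p∣+∣q∣ (x m ℚ.- x n) (y m ℚ.- y n) ⟩
      ℚ.∣ x m ℚ.- x n ∣ ℚ.+ ℚ.∣ y m ℚ.- y n ∣
        ≤⟨ ℚₚ.+-mono-≤
             (px m n (ℕₚ.m⊔n≤o⇒m≤o M N p) (ℕₚ.m⊔n≤o⇒m≤o M N q))
             (py m n (ℕₚ.m⊔n≤o⇒n≤o M N p) (ℕₚ.m⊔n≤o⇒n≤o M N q)) ⟩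
      ½ ℚ.* ε ℚ.+ ½ ℚ.* ε
        ≡⟨ half+half ε ⟩
      ε ∎
    where
    open ℚₚ.≤-Reasoning
    open +-*-Solver

  *-cauchy : ∀ q x → Cauchy x → Cauchy (λ n → q ℚ.* x n)
  *-cauchy q x cx ε 0<ε =
    let (N , px) = cx (ℚ.1/ b ℚ.* ε) 0<ε/b
    in N , λ m n p r → begin
      ℚ.∣ q ℚ.* x m ℚ.- q ℚ.* x n ∣
        ≡⟨ cong ℚ.∣_∣ (solve 3 (λ a c d → a :* c :- a :* d := a :* (c :- d))
                       refl q (x m) (x n)) ⟩
      ℚ.∣ q ℚ.* (x m ℚ.- x n) ∣
        ≡⟨ ℚₚ.∣p*q∣≡∣p∣*∣q∣ q (x m ℚ.- x n) ⟩
      ℚ.∣ q ∣ ℚ.* ℚ.∣ x m ℚ.- x n ∣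
        ≤⟨ ℚₚ.*-monoˡ-≤-nonNeg ℚ.∣ q ∣ (px m n p r) ⟩
      ℚ.∣ q ∣ ℚ.* (ℚ.1/ b ℚ.* ε)
        ≤⟨ ℚₚ.*-monoʳ-≤-nonNeg (ℚ.1/ b ℚ.* ε) ∣q∣≤b ⟩
      b ℚ.* (ℚ.1/ b ℚ.* ε)
        ≡⟨ sym (ℚₚ.*-assoc b (ℚ.1/ b) ε) ⟩
      (b ℚ.* ℚ.1/ b) ℚ.* ε
        ≡⟨ cong (ℚ._* ε) (ℚₚ.*-inverseʳ b) ⟩
      1ℚ ℚ.* ε
        ≡⟨ ℚₚ.*-identityˡ ε ⟩
      ε ∎
    where
    open ℚₚ.≤-Reasoning
    open +-*-Solver
    b : ℚ
    b = 1ℚ ℚ.+ ℚ.∣ q ∣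
    instance
      ∣q∣≥0 : ℚ.NonNegative ℚ.∣ q ∣
      ∣q∣≥0 = ℚ.nonNegative (ℚₚ.0≤∣p∣ q)
      b>0 : ℚ.Positive b
      b>0 = ℚₚ.pos+nonNeg⇒pos 1ℚ ℚ.∣ q ∣
      b≢0 : ℚ.NonZero b
      b≢0 = ℚₚ.pos⇒nonZero b
      1/b>0 : ℚ.Positive (ℚ.1/ b)
      1/b>0 = ℚₚ.1/pos⇒pos b
      ε>0 : ℚ.Positive ε
      ε>0 = ℚ.positive 0<ε
      ε/b>0 : ℚ.Positive (ℚ.1/ b ℚ.* ε)
      ε/b>0 = ℚₚ.pos*pos⇒pos (ℚ.1/ b) ε
      ε/b≥0 : ℚ.NonNegative (ℚ.1/ b ℚ.* ε)
      ε/b≥0 = ℚₚ.pos⇒nonNeg (ℚ.1/ b ℚ.* ε)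
    0<ε/b : 0ℚ ℚ.< ℚ.1/ b ℚ.* ε
    0<ε/b = ℚₚ.positive⁻¹ (ℚ.1/ b ℚ.* ε)
    ∣q∣≤b : ℚ.∣ q ∣ ℚ.≤ b
    ∣q∣≤b = subst (ℚ._≤ b) (ℚₚ.+-identityˡ ℚ.∣ q ∣)
              (ℚₚ.+-monoˡ-≤ ℚ.∣ q ∣ (ℚₚ.nonNegative⁻¹ 1ℚ))

fromℚ : ℚ → ℝ
fromℚ q = mkℝ (λ _ → q) (const-cauchy q)

fromℕ : ℕ → ℝ
fromℕ n = fromℚ (+ n ℚ./ 1)

0ℝ : ℝ
0ℝ = fromℚ 0ℚ

infixl 6 _+ᵣ_ _-ᵣ_
infixl 7 _·ᵣ_
infix  4 _≤ᵣ_

_+ᵣ_ : ℝ → ℝ → ℝ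
x +ᵣ y = mkℝ (λ n → approx x n ℚ.+ approx y n) (+-cauchy (approx x) (approx y) (cauchy x) (cauchy y))

_·ᵣ_ : ℚ → ℝ → ℝ
q ·ᵣ x = mkℝ (λ n → q ℚ.* approx x n) (*-cauchy q (approx x) (cauchy x))

_-ᵣ_ : ℝ → ℝ → ℝ
x -ᵣ y = x +ᵣ (ℚ.- 1ℚ) ·ᵣ y

_≤ᵣ_ : ℝ → ℝ → Set
x ≤ᵣ y = ∀ ε → 0ℚ ℚ.< ε → ∃[ N ] (∀ n → N ℕ.≤ n → approx x n ℚ.≤ approx y n ℚ.+ ε)

-- ∣ x - y ∣ ≤ ε
Within : ℚ → ℝ → ℝ → Set
Within ε x y = (x -ᵣ y ≤ᵣ fromℚ ε) × (y -ᵣ x ≤ᵣ fromℚ ε)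

2^-_ : ℕ → ℚ
2^- k = ((+ 1) ℚ./ (2 ^ k)) {{ℕₚ.m^n≢0 2 k}}

ConvergesTo : (ℕ → ℝ) → ℝ → Set
ConvergesTo s L = ∀ ε → 0ℚ ℚ.< ε → ∃[ N ] (∀ n → N ℕ.≤ n → Within ε (s n) L)

TendsTo∞ : (ℕ → ℝ) → Set
TendsTo∞ s = ∀ (B : ℚ) → ∃[ N ] (∀ n → N ℕ.≤ n → fromℚ B ≤ᵣ s n)

partialSum : (ℕ → ℝ) → ℕ → ℝ
partialSum a zero    = 0ℝ
partialSum a (suc n) = partialSum a n +ᵣ a n

SeriesConverges : (ℕ → ℝ) → Set
SeriesConverges a = ∃[ L ] ConvergesTo (partialSum a) L

------------------------------------------------------------------------
-- Partial recursive functions, relative to a family of oracles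
-- indexed by Ω.  Rec ⊥ n are the ordinary n-ary partial recursive
-- functions (Kleene's μ-recursive ones).

data Rec (Ω : Set) : ℕ → Set where
  zer    : ∀ {n} → Rec Ω n
  succ   : Rec Ω 1
  proj   : ∀ {n} → Fin n → Rec Ω n
  oracle : Ω → Rec Ω 1
  comp   : ∀ {m n} → Rec Ω m → Vec (Rec Ω n) m → Rec Ω n
  prec   : ∀ {n} → Rec Ω n → Rec Ω (suc (suc n)) → Rec Ω (suc n)
  mu     : ∀ {n} → Rec Ω (suc n) → Rec Ω n

-- o ⊢ e ∙ xs ⇓ v : the function denoted by e, with oracles o, is defined
-- at xs and has value v there.
infix 4 _⊢_∙_⇓_ _⊢_∙_⇓*_

data _⊢_∙_⇓_  {Ω : Set} (o : Ω → ℕ → ℕ) : ∀ {n} → Rec Ω n → Vec ℕ n → ℕ → Set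
data _⊢_∙_⇓*_ {Ω : Set} (o : Ω → ℕ → ℕ) :
  ∀ {m n} → Vec (Rec Ω n) m → Vec ℕ n → Vec ℕ m → Set

data _⊢_∙_⇓_ {Ω} o where
  ⇓zer    : ∀ {n} {xs : Vec ℕ n} → o ⊢ zer ∙ xs ⇓ 0
  ⇓succ   : ∀ {x} → o ⊢ succ ∙ x ∷ [] ⇓ suc x
  ⇓proj   : ∀ {n} {xs : Vec ℕ n} (i : Fin n) → o ⊢ proj i ∙ xs ⇓ lookup xs i
  ⇓oracle : ∀ {x} (ω : Ω) → o ⊢ oracle ω ∙ x ∷ [] ⇓ o ω x
  ⇓comp   : ∀ {m n} {f : Rec Ω m} {gs : Vec (Rec Ω n) m} {xs ys v} →
            o ⊢ gs ∙ xs ⇓* ys → o ⊢ f ∙ ys ⇓ v → o ⊢ comp f gs ∙ xs ⇓ v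
  ⇓prec₀  : ∀ {n} {g : Rec Ω n} {h xs v} →
            o ⊢ g ∙ xs ⇓ v → o ⊢ prec g h ∙ 0 ∷ xs ⇓ v
  ⇓precₛ  : ∀ {n} {g : Rec Ω n} {h xs k u v} →
            o ⊢ prec g h ∙ k ∷ xs ⇓ u → o ⊢ h ∙ k ∷ u ∷ xs ⇓ v →
            o ⊢ prec g h ∙ suc k ∷ xs ⇓ v
  ⇓mu     : ∀ {n} {f : Rec Ω (suc n)} {xs k} →
            o ⊢ f ∙ k ∷ xs ⇓ 0 →
            (∀ j → j ℕ.< k → ∃[ v ] (o ⊢ f ∙ j ∷ xs ⇓ suc v)) →
            o ⊢ mu f ∙ xs ⇓ k

data _⊢_∙_⇓*_ {Ω} o where
  []  : ∀ {n} {xs : Vec ℕ n} → o ⊢ [] ∙ xs ⇓* []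
  _∷_ : ∀ {m n} {g : Rec Ω n} {gs : Vec (Rec Ω n) m} {xs y ys} →
        o ⊢ g ∙ xs ⇓ y → o ⊢ gs ∙ xs ⇓* ys → o ⊢ g ∷ gs ∙ xs ⇓* y ∷ ys

noOracle : ⊥ → ℕ → ℕ
noOracle ()

Recursive₂ : (ℕ → ℕ → ℕ) → Set
Recursive₂ g = ∃[ e ] (∀ m n → noOracle ⊢ e ∙ m ∷ n ∷ [] ⇓ g m n)

-- A sequence of reals is uniformly computable if a computable double
-- sequence of rationals r satisfies ∣ r n k - f n ∣ ≤ 2^-k; here
-- r n k = (a n k - b n k) / (d n k + 1) with a, b, d recursive.
Computable : (ℕ → ℝ) → Set
Computable f =
  ∃[ a ] ∃[ b ] ∃[ d ] (Recursive₂ a × Recursive₂ b × Recursive₂ d ×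
    (∀ n k → Within (2^- k) (fromℚ ((a n k ⊖ b n k) ℚ./ suc (d n k))) (f n)))

record OrderFunction (f : ℕ → ℝ) : Set where
  field
    computable    : Computable f
    nondecreasing : ∀ {m n} → m ℕ.≤ n → f m ≤ᵣ f n
    unbounded     : ¬ (∃[ B ] (∀ n → f n ≤ᵣ B))

SubIdentical : (ℕ → ℝ) → Set
SubIdentical f = TendsTo∞ (λ n → fromℕ n -ᵣ f n)

------------------------------------------------------------------------
-- The bijection {0,1}* → ℕ given by bijective base-2 numeration (least
-- significant digit first), through which machines act on strings.
code : List Bool → ℕ
code []          = 0
code (false ∷ σ) = 1 ℕ.+ 2 ℕ.* code σ
code (true  ∷ σ) = 2 ℕ.+ 2 ℕ.* code σ

infix 4 _⟪_⟫≃_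

_⟪_⟫≃_ : Rec ⊥ 1 → List Bool → List Bool → Set
M ⟪ σ ⟫≃ τ = noOracle ⊢ M ∙ code σ ∷ [] ⇓ code τ

Dom : Rec ⊥ 1 → Pred (List Bool) 0ℓ
Dom M σ = ∃[ τ ] (M ⟪ σ ⟫≃ τ)

PrefixFree : Rec ⊥ 1 → Set
PrefixFree M = ∀ σ τ → Dom M σ → Dom M τ → Prefix _≡_ σ τ → σ ≡ τ

record Universal (U : Rec ⊥ 1) : Set where
  field
    prefixFree : PrefixFree U
    simulates  : ∀ M → PrefixFree M →
      ∃[ ρ ] (∀ τ υ → (U ⟪ ρ ++ τ ⟫≃ υ → M ⟪ τ ⟫≃ υ) × (M ⟪ τ ⟫≃ υ → U ⟪ ρ ++ τ ⟫≃ υ))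

-- K U σ k says that k is the minimum of ∣τ∣ over the τ with U(τ) = σ.
K : Rec ⊥ 1 → List Bool → ℕ → Set
K U σ k = (∃[ τ ] (U ⟪ τ ⟫≃ σ × length τ ≡ k))
        × (∀ τ → U ⟪ τ ⟫≃ σ → k ℕ.≤ length τ)

-- K(σ) ≥ r.  For universal U the minimum exists for every σ, but only
-- classically, so the value of K at σ is quantified over universally.
K[_]_≥_ : Rec ⊥ 1 → List Bool → ℝ → Set
K[ U ] σ ≥ r = ∀ k → K U σ k → r ≤ᵣ fromℕ k

_↾_ : (ℕ → Bool) → ℕ → List Bool
X ↾ n = applyUpTo X n

_SubstringOf_ : List Bool → (ℕ → Bool) → Set
τ SubstringOf X = ∃[ i ] (τ ≡ applyUpTo (λ j → X (i ℕ.+ j)) (length τ))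

COMPLEX : Rec ⊥ 1 → ℝ → Pred (ℕ → Bool) 0ℓ
COMPLEX U δ X = ∃[ c ] (∀ n → K[ U ] (X ↾ n) ≥ ((+ n ℚ./ 1) ·ᵣ δ -ᵣ fromℕ c))

SC : Rec ⊥ 1 → (ℕ → ℝ) → Pred (ℕ → Bool) 0ℓ
SC U f X = ∃[ c ] (∀ τ → τ SubstringOf X → K[ U ] τ ≥ (f (length τ) -ᵣ fromℕ c))

------------------------------------------------------------------------
-- A subset of {0,1}^ℕ viewed as a subset of ℕ^ℕ.
⌜_⌝ : Pred (ℕ → Bool) 0ℓ → Pred (ℕ → ℕ) 0ℓ
⌜ P ⌝ g = ∃[ X ] (P X × (∀ n → g n ≡ (if X n then 1 else 0)))

-- Strong (Medvedev) reducibility: Φ is a partial recursive functional,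
-- i.e. a one-place program with a single oracle g.
infix 4 _≤ₛ_

_≤ₛ_ : Pred (ℕ → ℕ) 0ℓ → Pred (ℕ → ℕ) 0ℓ → Set
P ≤ₛ Q = ∃[ Φ ] (∀ g → Q g →
  ∃[ h ] (P h × (∀ n → (λ (_ : ⊤) → g) ⊢ Φ ∙ n ∷ [] ⇓ h n)))

{-# OPTIONS --safe #-}
-- Let F ≥ f be a recursive natural-valued bound within 3 of f, and D a natural number with D δ ≥ 1.
-- Put g m = D (F (2^(m+3)) + 2 m) for m ≥ m₀ and g m = 0 below m₀.  Since Σ g m / 2^m converges, m₀
-- can be chosen so that the sum is at most 1, and then (Kraft) disjoint residue classes mod 2^m can
-- be assigned recursively to all pairs (m , i) with i < g m.  Given X, let Y carry the bit X i on the
-- class of (m , i).  Every substring τ of Y with |τ| ≥ 2^(m+2) contains an aligned block of length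
-- 2^m and hence determines X ↾ g m, as soon as the starting position of τ mod 2^m is known.  A
-- prefix-free machine that reads this residue in a header of 2 m + 1 bits, followed by a program for
-- τ, shows δ (g m) - c ≤ K(X ↾ g m) ≤ K(τ) + 2 m + c′, that is F (2^(m+3)) ≤ K(τ) + c″; and if m is
-- the largest level available for τ, then f |τ| ≤ F (2^(m+3)).
module Submission where

open import Defs
open import Data.Bool using (Bool; true; false; if_then_else_)
open import Data.Empty using (⊥; ⊥-elim)
open import Data.Fin using (Fin)
open import Data.Fin.Patterns
import Data.Integer as ℤ
import Data.Integer.Properties as ℤₚ
open import Data.List using (List; []; _∷_; _++_; length; applyUpTo; drop; _∷ʳ_)
open import Data.List.Properties
  using (applyUpTo-∷ʳ; length-applyUpTo; length-++; drop-[]; ++-identityʳ; ++-identityʳ-unique)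
open import Data.List.Relation.Binary.Pointwise as Pointwise using (Pointwise-≡⇒≡)
import Data.List.Relation.Binary.Prefix.Heterogeneous as Prefix
open import Data.Nat as ℕ using (ℕ; zero; suc; _^_; z≤n; s≤s)
import Data.Nat.Properties as ℕₚ
import Data.Nat.Solver as ℕSolver
open import Data.Product using (∃-syntax; _×_; _,_; proj₁; proj₂)
open import Data.Rational as ℚ using (ℚ; 0ℚ; 1ℚ; ½; mkℚ; toℚᵘ)
import Data.Rational.Properties as ℚₚ
import Data.Rational.Unnormalised as ℚᵘ
import Data.Rational.Unnormalised.Properties as ℚᵘₚ
open import Data.Sum using (inj₁; inj₂; [_,_]′)
open import Data.Unit using (tt)
open import Data.Vec using (Vec; []; _∷_; lookup; head; tail)
open import Function using (_∘_)
open import Relation.Binary.Definitions using (tri<; tri≈; tri>)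
open import Relation.Binary.PropositionalEquality
open import Relation.Nullary using (¬_; yes; no; contradiction)
open import Relation.Nullary.Decidable using (decidable-stable)

-- The assignment of classes is greedy. In the order of reversed digits the class of rank r mod 2^m
-- splits into the classes of ranks 2 r and 2 r + 1 mod 2^(m+1). So what the earlier levels have
-- taken is always an initial segment, and one counter per level replaces the search for free
-- classes. Kraft's inequality only has to keep this counter within 2^m. A substring does not reveal
-- where it starts, so the decoder must be told a residue. The header holds a string β of length m
-- whose bijective base-2 value is the number of bits to skip before the aligned block. The values
-- of the strings of length m are the 2^m consecutive numbers from 2^m - 1 on, so β conveys both m
-- and the residue. Its cost is affordable because 2 m / 2^m is summable too. The threshold m₀ is
-- fixed by f, δ and the convergence of the series; the constant c of X enters only the final
-- constant for Y, so one program serves every X.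

module Programs where

  open import Data.Nat using (pred; _+_; _*_; _∸_)
  open import Data.Nat.Properties

  -- Recursive functions paired with their programs, and combinators to build them.

  record Recursive {n} (f : Vec ℕ n → ℕ) : Set where
    constructor mkRecursive
    field
      program : Rec ⊥ n
      correct : ∀ xs → noOracle ⊢ program ∙ xs ⇓ f xs

  open Recursive

  module _ {Ω : Set} {o : Ω → ℕ → ℕ} where

    ⇓-value : ∀ {n} {e : Rec Ω n} {xs u v} → u ≡ v → o ⊢ e ∙ xs ⇓ u → o ⊢ e ∙ xs ⇓ v
    ⇓-value refl p = p

    ⇓-argument : ∀ {e : Rec Ω 1} {x y v} → x ≡ y → o ⊢ e ∙ x ∷ [] ⇓ v → o ⊢ e ∙ y ∷ [] ⇓ v
    ⇓-argument refl p = p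

  uncurry₁ : (ℕ → ℕ) → Vec ℕ 1 → ℕ
  uncurry₁ f (x ∷ []) = f x

  uncurry₂ : (ℕ → ℕ → ℕ) → Vec ℕ 2 → ℕ
  uncurry₂ f (x ∷ y ∷ []) = f x y

  uncurry₃ : (ℕ → ℕ → ℕ → ℕ) → Vec ℕ 3 → ℕ
  uncurry₃ f (x ∷ y ∷ z ∷ []) = f x y z

  uncurry₄ : (ℕ → ℕ → ℕ → ℕ → ℕ) → Vec ℕ 4 → ℕ
  uncurry₄ f (w ∷ x ∷ y ∷ z ∷ []) = f w x y z

  -- Vectors have no definitional eta, so the program is kept and only its correctness is restated,
  -- after matching on the vector.
  lam₁ : ∀ {h} → Recursive h → Recursive (uncurry₁ λ x → h (x ∷ []))
  lam₁ r = mkRecursive (program r) λ { (x ∷ []) → correct r (x ∷ []) }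

  lam₂ : ∀ {h} → Recursive h → Recursive (uncurry₂ λ x y → h (x ∷ y ∷ []))
  lam₂ r = mkRecursive (program r) λ { (x ∷ y ∷ []) → correct r (x ∷ y ∷ []) }

  lam₃ : ∀ {h} → Recursive h → Recursive (uncurry₃ λ x y z → h (x ∷ y ∷ z ∷ []))
  lam₃ r = mkRecursive (program r) λ { (x ∷ y ∷ z ∷ []) → correct r (x ∷ y ∷ z ∷ []) }

  lam₄ : ∀ {h} → Recursive h → Recursive (uncurry₄ λ w x y z → h (w ∷ x ∷ y ∷ z ∷ []))
  lam₄ r = mkRecursive (program r)
    λ { (w ∷ x ∷ y ∷ z ∷ []) → correct r (w ∷ x ∷ y ∷ z ∷ []) }

  module _ {n : ℕ} where

    var : (i : Fin n) → Recursive (λ xs → lookup xs i)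
    var i = mkRecursive (proj i) λ _ → ⇓proj i

    const : ∀ k → Recursive {n} (λ _ → k)
    const zero    = mkRecursive zer λ _ → ⇓zer
    const (suc k) = let r = const k in
      mkRecursive (comp succ (program r ∷ [])) λ xs → ⇓comp (correct r xs ∷ []) ⇓succ

    app₁ : ∀ {f} {g : Vec ℕ n → ℕ} → Recursive (uncurry₁ f) →
           Recursive g → Recursive (λ xs → f (g xs))
    app₁ {g = g} r s = mkRecursive (comp (program r) (program s ∷ []))
      λ xs → ⇓comp (correct s xs ∷ []) (correct r (g xs ∷ []))

    app₂ : ∀ {f} {g h : Vec ℕ n → ℕ} → Recursive (uncurry₂ f) →
           Recursive g → Recursive h → Recursive (λ xs → f (g xs) (h xs))
    app₂ {g = g} {h} r s t = mkRecursive (comp (program r) (program s ∷ program t ∷ []))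
      λ xs → ⇓comp (correct s xs ∷ correct t xs ∷ []) (correct r (g xs ∷ h xs ∷ []))

    app₄ : ∀ {f} {g h k l : Vec ℕ n → ℕ} → Recursive (uncurry₄ f) →
           Recursive g → Recursive h → Recursive k → Recursive l →
           Recursive (λ xs → f (g xs) (h xs) (k xs) (l xs))
    app₄ {g = g} {h} {k} {l} r s t u v =
      mkRecursive (comp (program r) (program s ∷ program t ∷ program u ∷ program v ∷ []))
      λ xs → ⇓comp (correct s xs ∷ correct t xs ∷ correct u xs ∷ correct v xs ∷ [])
                   (correct r (g xs ∷ h xs ∷ k xs ∷ l xs ∷ []))

    -- The function is written directly in Agda; if its clauses already have the primitive recursive
    -- shape, the last argument is `refl`. This is why arithmetic below is redefined by recursion on
    -- one argument.
    primRec : (F : ℕ → Vec ℕ n → ℕ) {s : Vec ℕ (suc (suc n)) → ℕ} →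
              Recursive (F 0) → Recursive s →
              (∀ k xs → F (suc k) xs ≡ s (k ∷ F k xs ∷ xs)) →
              Recursive (λ ys → F (head ys) (tail ys))
    primRec F base step eq = mkRecursive (prec (program base) (program step))
      λ { (k ∷ xs) → go k xs }
      where
      go : ∀ k xs → noOracle ⊢ prec (program base) (program step) ∙ k ∷ xs ⇓ F k xs
      go zero    xs = ⇓prec₀ (correct base xs)
      go (suc k) xs = ⇓-value (sym (eq k xs))
        (⇓precₛ (go k xs) (correct step (k ∷ F k xs ∷ xs)))

  fromRecursive₂ : ∀ {g} → Recursive₂ g → Recursive (uncurry₂ g)
  fromRecursive₂ (e , p) = mkRecursive e λ { (m ∷ n ∷ []) → p m n }

  module _ {Ω : Set} where

    relativize  : ∀ {n} → Rec ⊥ n → Rec Ω n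
    relativize* : ∀ {m n} → Vec (Rec ⊥ n) m → Vec (Rec Ω n) m
    relativize zer         = zer
    relativize succ        = succ
    relativize (proj i)    = proj i
    relativize (oracle ())
    relativize (comp f gs) = comp (relativize f) (relativize* gs)
    relativize (prec g h)  = prec (relativize g) (relativize h)
    relativize (mu f)      = mu (relativize f)
    relativize* []         = []
    relativize* (g ∷ gs)   = relativize g ∷ relativize* gs

  module _ {Ω : Set} (o : Ω → ℕ → ℕ) where

    relativize-⇓  : ∀ {n} {e : Rec ⊥ n} {xs v} → noOracle ⊢ e ∙ xs ⇓ v → o ⊢ relativize e ∙ xs ⇓ v
    relativize-⇓* : ∀ {m n} {es : Vec (Rec ⊥ n) m} {xs vs} →
                    noOracle ⊢ es ∙ xs ⇓* vs → o ⊢ relativize* es ∙ xs ⇓* vs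
    relativize-⇓ ⇓zer         = ⇓zer
    relativize-⇓ ⇓succ        = ⇓succ
    relativize-⇓ (⇓proj i)    = ⇓proj i
    relativize-⇓ (⇓oracle ())
    relativize-⇓ (⇓comp p q)  = ⇓comp (relativize-⇓* p) (relativize-⇓ q)
    relativize-⇓ (⇓prec₀ p)   = ⇓prec₀ (relativize-⇓ p)
    relativize-⇓ (⇓precₛ p q) = ⇓precₛ (relativize-⇓ p) (relativize-⇓ q)
    relativize-⇓ (⇓mu p q)    =
      ⇓mu (relativize-⇓ p) (λ j j<k → let (v , r) = q j j<k in v , relativize-⇓ r)
    relativize-⇓* []       = []
    relativize-⇓* (p ∷ ps) = relativize-⇓ p ∷ relativize-⇓* ps

    ⇓-functional  : ∀ {n} {e : Rec Ω n} {xs u v} → o ⊢ e ∙ xs ⇓ u → o ⊢ e ∙ xs ⇓ v → u ≡ v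
    ⇓*-functional : ∀ {m n} {es : Vec (Rec Ω n) m} {xs us vs} →
                    o ⊢ es ∙ xs ⇓* us → o ⊢ es ∙ xs ⇓* vs → us ≡ vs
    ⇓-functional ⇓zer ⇓zer = refl
    ⇓-functional ⇓succ ⇓succ = refl
    ⇓-functional (⇓proj i) (⇓proj .i) = refl
    ⇓-functional (⇓oracle ω) (⇓oracle .ω) = refl
    ⇓-functional (⇓comp p q) (⇓comp p′ q′) with refl ← ⇓*-functional p p′ = ⇓-functional q q′
    ⇓-functional (⇓prec₀ p) (⇓prec₀ p′) = ⇓-functional p p′
    ⇓-functional (⇓precₛ p q) (⇓precₛ p′ q′) with refl ← ⇓-functional p p′ = ⇓-functional q q′
    ⇓-functional (⇓mu {k = k} p q) (⇓mu {k = l} p′ q′) with <-cmp k l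
    ... | tri≈ _ k≡l _ = k≡l
    ... | tri< k<l _ _ with () ← ⇓-functional p (proj₂ (q′ k k<l))
    ... | tri> _ _ l<k with () ← ⇓-functional (proj₂ (q l l<k)) p′
    ⇓*-functional [] [] = refl
    ⇓*-functional (p ∷ ps) (p′ ∷ ps′) = cong₂ _∷_ (⇓-functional p p′) (⇓*-functional ps ps′)

  suc-rec : Recursive (uncurry₁ suc)
  suc-rec = mkRecursive succ λ { (x ∷ []) → ⇓succ }

  +-rec : Recursive (uncurry₂ _+_)
  +-rec = lam₂ (primRec (λ k xs → k + lookup xs 0F) (var 0F) (app₁ suc-rec (var 1F)) λ _ _ → refl)

  *-rec : Recursive (uncurry₂ _*_)
  *-rec = lam₂ (primRec (λ k xs → k * lookup xs 0F) (const 0) (app₂ +-rec (var 2F) (var 1F))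
    λ _ _ → refl)

  pred-rec : Recursive (uncurry₁ pred)
  pred-rec = lam₁ (primRec (λ k _ → pred k) (const 0) (var 0F) λ _ _ → refl)

  ∸-rec : Recursive (uncurry₂ _∸_)
  ∸-rec = lam₂ (app₂ (lam₂ (primRec (λ k xs → lookup xs 0F ∸ k) (var 0F) (app₁ pred-rec (var 1F))
    λ k xs → sym (pred[m∸n]≡m∸[1+n] (lookup xs 0F) k))) (var 1F) (var 0F))

  2^-rec : Recursive (uncurry₁ (2 ^_))
  2^-rec = lam₁ (primRec (λ k _ → 2 ^ k) (const 1) (app₂ *-rec (const 2) (var 1F)) λ _ _ → refl)

open Programs
open Recursive

module Allocations where

  open import Data.Nat using (_+_; _*_; _∸_; _≤_; _<_; s<s; _≤?_)
  open import Data.Nat.Properties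
  open import Data.Nat.Solver using (module +-*-Solver)

  -- Binary digits and the assignment of residue classes.

  parity : ℕ → ℕ
  parity zero    = 0
  parity (suc n) = 1 ∸ parity n

  half : ℕ → ℕ
  half zero    = 0
  half (suc n) = half n + parity n

  parity≤1 : ∀ n → parity n ≤ 1
  parity≤1 zero    = z≤n
  parity≤1 (suc n) = m∸n≤m 1 (parity n)

  parity-2+ : ∀ n → parity (2 + n) ≡ parity n
  parity-2+ n = m∸[m∸n]≡n (parity≤1 n)

  half-2+ : ∀ n → half (2 + n) ≡ suc (half n)
  half-2+ n = begin
    half n + parity n + (1 ∸ parity n)   ≡⟨ +-assoc (half n) _ _ ⟩
    half n + (parity n + (1 ∸ parity n)) ≡⟨ cong (half n +_) (m+[n∸m]≡n (parity≤1 n)) ⟩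
    half n + 1                           ≡⟨ +-comm (half n) 1 ⟩
    suc (half n) ∎
    where open ≡-Reasoning

  parity+2*half : ∀ n → parity n + 2 * half n ≡ n
  parity+2*half zero          = refl
  parity+2*half (suc zero)    = refl
  parity+2*half (suc (suc n)) rewrite parity-2+ n | half-2+ n = begin
    parity n + 2 * suc (half n)   ≡⟨ solve 2 (λ p h → p :+ con 2 :* (con 1 :+ h) :=
                                                con 2 :+ (p :+ con 2 :* h)) refl (parity n) (half n) ⟩
    2 + (parity n + 2 * half n)   ≡⟨ cong (2 +_) (parity+2*half n) ⟩
    2 + n ∎
    where open ≡-Reasoning
          open +-*-Solver

  m+2*[1+n] : ∀ m n → m + 2 * suc n ≡ 2 + (m + 2 * n)
  m+2*[1+n] = solve 2 (λ m n → m :+ con 2 :* (con 1 :+ n) := con 2 :+ (m :+ con 2 :* n)) refl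
    where open +-*-Solver

  parity-+2* : ∀ m n → parity (m + 2 * n) ≡ parity m
  parity-+2* m zero    = cong parity (+-identityʳ m)
  parity-+2* m (suc n) rewrite m+2*[1+n] m n = trans (parity-2+ (m + 2 * n)) (parity-+2* m n)

  half-+2* : ∀ m n → half (m + 2 * n) ≡ half m + n
  half-+2* m zero    = trans (cong half (+-identityʳ m)) (sym (+-identityʳ (half m)))
  half-+2* m (suc n) rewrite m+2*[1+n] m n =
    trans (half-2+ (m + 2 * n)) (trans (cong suc (half-+2* m n)) (sym (+-suc (half m) n)))

  parity-parity : ∀ n → parity (parity n) ≡ parity n
  parity-parity n = trans (sym (parity-+2* (parity n) (half n))) (cong parity (parity+2*half n))

  half-< : ∀ {m n} → m < 2 * n → half m < n
  half-< {m} m<2n = *-cancelˡ-< 2 _ _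
    (≤-<-trans (≤-trans (m≤n+m (2 * half m) (parity m)) (≤-reflexive (parity+2*half m))) m<2n)

  -- This is ⌊n / 2^m⌋, so its parity is the binary digit of n at place m.
  halves : ℕ → ℕ → ℕ
  halves zero    n = n
  halves (suc m) n = half (halves m n)

  halves-suc : ∀ m n → halves (suc m) n ≡ halves m (half n)
  halves-suc zero    n = refl
  halves-suc (suc m) n = cong half (halves-suc m n)

  halves-+* : ∀ m {r} q → r < 2 ^ m → halves m (r + q * 2 ^ m) ≡ q
  halves-+* zero    {zero} q _           = *-identityʳ q
  halves-+* zero    {suc _} q (s≤s ())
  halves-+* (suc m) {r} q r<2^ = begin
    halves (suc m) (r + q * 2 ^ suc m)    ≡⟨ halves-suc m _ ⟩
    halves m (half (r + q * 2 ^ suc m))   ≡⟨ cong (λ x → halves m (half (r + x)))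
                                               (*-swap q 2 (2 ^ m)) ⟩
    halves m (half (r + 2 * (q * 2 ^ m))) ≡⟨ cong (halves m) (half-+2* r (q * 2 ^ m)) ⟩
    halves m (half r + q * 2 ^ m)         ≡⟨ halves-+* m q (half-< r<2^) ⟩
    q ∎
    where
    open ≡-Reasoning
    *-swap : ∀ a b c → a * (b * c) ≡ b * (a * c)
    *-swap = solve 3 (λ a b c → a :* (b :* c) := b :* (a :* c)) refl
      where open +-*-Solver

  -- rev m n reverses the last m binary digits of n.
  rev : ℕ → ℕ → ℕ
  rev zero    n = 0
  rev (suc m) n = 2 * rev m n + parity (halves m n)

  rev-suc-≤ : ∀ m n → rev (suc m) n ≤ 2 * rev m n + 1
  rev-suc-≤ m n = +-monoʳ-≤ (2 * rev m n) (parity≤1 (halves m n))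

  -- One more digit sends rank r to 2 r or 2 r + 1; this is what keeps the taken classes an initial
  -- segment.
  rev-suc-< : ∀ m n {k} → rev m n < k → rev (suc m) n < 2 * k
  rev-suc-< m n {k} lt = begin-strict
    rev (suc m) n         ≤⟨ rev-suc-≤ m n ⟩
    2 * rev m n + 1       <⟨ +-monoʳ-< (2 * rev m n) (s<s (s≤s z≤n)) ⟩
    2 * rev m n + 2       ≡⟨ solve 1 (λ r → con 2 :* r :+ con 2 := con 2 :* (con 1 :+ r)) refl (rev m n) ⟩
    2 * suc (rev m n)     ≤⟨ *-monoʳ-≤ 2 lt ⟩
    2 * k ∎
    where
    open ≤-Reasoning
    open +-*-Solver

  rev<2^ : ∀ m n → rev m n < 2 ^ m
  rev<2^ zero    n = s≤s z≤n
  rev<2^ (suc m) n = rev-suc-< m n (rev<2^ m n)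

  -- The definition of `rev` peels off the highest of the m digits; here the lowest digit is peeled
  -- off instead and becomes the highest. Inverting `rev` needs both recursions.
  rev-suc : ∀ m n → rev (suc m) n ≡ rev m (half n) + parity n * 2 ^ m
  rev-suc zero    n = sym (*-identityʳ (parity n))
  rev-suc (suc m) n = begin
    2 * rev (suc m) n + parity (halves (suc m) n)
      ≡⟨ cong₂ (λ x y → 2 * x + parity y) (rev-suc m n) (halves-suc m n) ⟩
    2 * (rev m (half n) + parity n * 2 ^ m) + parity (halves m (half n))
      ≡⟨ solve 4 (λ a b c d → con 2 :* (a :+ b :* c) :+ d := con 2 :* a :+ d :+ b :* (con 2 :* c))
           refl (rev m (half n)) (parity n) (2 ^ m) (parity (halves m (half n))) ⟩
    rev (suc m) (half n) + parity n * 2 ^ suc m ∎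
    where
    open ≡-Reasoning
    open +-*-Solver

  -- Reversal is an involution on m digits and ignores multiples of 2^m. Hence the numbers
  -- `rev m x + q * 2 ^ m` are the members of the class of rank x.
  rev-rev : ∀ m {x} q → x < 2 ^ m → rev m (rev m x + q * 2 ^ m) ≡ x
  rev-rev zero    {zero}  q _ = refl
  rev-rev zero    {suc _} q (s≤s ())
  rev-rev (suc m) {x} q x<2^ = begin
    2 * rev m (rev (suc m) x + q * 2 ^ suc m) + parity (halves m (rev (suc m) x + q * 2 ^ suc m))
      ≡⟨ cong (λ y → 2 * rev m y + parity (halves m y)) regroup ⟩
    2 * rev m (rev m (half x) + q′ * 2 ^ m) + parity (halves m (rev m (half x) + q′ * 2 ^ m))
      ≡⟨ cong₂ (λ y z → 2 * y + parity z) (rev-rev m q′ (half-< x<2^))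
           (halves-+* m q′ (rev<2^ m (half x))) ⟩
    2 * half x + parity q′
      ≡⟨ cong (2 * half x +_) (trans (parity-+2* (parity x) q) (parity-parity x)) ⟩
    2 * half x + parity x
      ≡⟨ +-comm (2 * half x) (parity x) ⟩
    parity x + 2 * half x
      ≡⟨ parity+2*half x ⟩
    x ∎
    where
    open ≡-Reasoning
    -- The highest digit of `rev (suc m) x` is the lowest digit of x; it is absorbed into the
    -- quotient so that the induction hypothesis applies mod 2^m.
    q′ = parity x + 2 * q
    regroup : rev (suc m) x + q * 2 ^ suc m ≡ rev m (half x) + q′ * 2 ^ m
    regroup = trans (cong (_+ q * 2 ^ suc m) (rev-suc m x))
      (solve 4 (λ r p k a → r :+ p :* k :+ a :* (con 2 :* k) := r :+ (p :+ con 2 :* a) :* k)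
        refl (rev m (half x)) (parity x) (2 ^ m) q)
      where open +-*-Solver

  parity-rec : Recursive (uncurry₁ parity)
  parity-rec = lam₁ (primRec (λ k _ → parity k) (const 0) (app₂ ∸-rec (const 1) (var 1F)) λ _ _ → refl)

  half-rec : Recursive (uncurry₁ half)
  half-rec = lam₁ (primRec (λ k _ → half k) (const 0)
    (app₂ +-rec (var 1F) (app₁ parity-rec (var 0F))) λ _ _ → refl)

  halves-rec : Recursive (uncurry₂ halves)
  halves-rec = lam₂ (primRec (λ k xs → halves k (lookup xs 0F)) (var 0F)
    (app₁ half-rec (var 1F)) λ _ _ → refl)

  rev-rec : Recursive (uncurry₂ rev)
  rev-rec = lam₂ (primRec (λ k xs → rev k (lookup xs 0F)) (const 0)
    (app₂ +-rec (app₂ *-rec (const 2) (var 1F))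
                (app₁ parity-rec (app₂ halves-rec (var 0F) (var 2F)))) λ _ _ → refl)

  -- Level m deals with the residue classes mod 2^m, ordered by rev m: those below offset m are taken
  -- by earlier levels, and the next g m of them are assigned to the indices 0, …, g m - 1.
  module Allocation (g : ℕ → ℕ) where

    -- `offset m` / 2^m is the sum of g k / 2^k over k < m, the density already taken. Thus
    -- `offset m + g m ≤ 2 ^ m` is Kraft's inequality up to level m.
    offset : ℕ → ℕ
    offset zero    = 0
    offset (suc m) = 2 * (offset m + g m)

    -- level k n is the least m < k with rev m n < offset m + g m, and k if there is none;
    -- 1 ∸ (x ∸ y) is the indicator of x ≤ y.
    level : ℕ → ℕ → ℕ
    level zero    n = 0
    level (suc k) n = level k n + (1 ∸ (offset (level k n) + g (level k n) ∸ rev (level k n) n))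

    -- Bounding the search by n itself keeps this primitive recursive. The price is that a class of
    -- level m is honoured only at positions n ≥ m; other positions receive some index that is never
    -- read.
    owner : ℕ → ℕ
    owner n = rev (level n n) n ∸ offset (level n n)

    rev<offset : ∀ {j m} n → j ℕ.≤′ m → rev j n < offset j → rev m n < offset m
    rev<offset n ℕ.≤′-refl lt = lt
    rev<offset n (ℕ.≤′-step {m} j≤m) lt =
      rev-suc-< m n (<-≤-trans (rev<offset n j≤m lt) (m≤m+n (offset m) (g m)))

    -- Disjointness of the levels: had an earlier level j taken the class of n, its rank would have
    -- stayed below the offset ever after.
    offset+g≤rev : ∀ {j m} n → j < m → offset m ≤ rev m n → offset j + g j ≤ rev j n
    offset+g≤rev {j} n j<m le = ≮⇒≥ λ lt →
      <⇒≱ (rev<offset n (≤⇒≤′ j<m) (rev-suc-< j n lt)) le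

    module _ {m n} (lo : offset m ≤ rev m n) (hi : rev m n < offset m + g m) where

      level-before : ∀ k → k ≤ m → level k n ≡ k
      level-before zero    _   = refl
      level-before (suc k) k<m rewrite level-before k (<⇒≤ k<m)
        | m≤n⇒m∸n≡0 (offset+g≤rev n k<m lo) = +-comm k 1

      level-after : ∀ d → level (d + m) n ≡ m
      level-after zero    = level-before m ≤-refl
      level-after (suc d) rewrite level-after d
        | m≤n⇒m∸n≡0 (m<n⇒0<n∸m hi) = +-identityʳ m

      level-found : m ≤ n → level n n ≡ m
      level-found m≤n = subst (λ k → level k n ≡ m) (m∸n+n≡m m≤n) (level-after (n ∸ m))

      owner-found : m ≤ n → owner n ≡ rev m n ∸ offset m
      owner-found m≤n = cong (λ k → rev k n ∸ offset k) (level-found m≤n)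

    owner-class : ∀ {m i} q → offset m + g m ≤ 2 ^ m → i < g m →
                  m ≤ rev m (offset m + i) + q * 2 ^ m → owner (rev m (offset m + i) + q * 2 ^ m) ≡ i
    owner-class {m} {i} q fits i<g m≤n = begin
      owner n              ≡⟨ owner-found (subst (offset m ≤_) (sym r) (m≤m+n (offset m) i))
                                          (subst (_< offset m + g m) (sym r) (+-monoʳ-< (offset m) i<g)) m≤n ⟩
      rev m n ∸ offset m   ≡⟨ cong (_∸ offset m) r ⟩
      offset m + i ∸ offset m ≡⟨ m+n∸m≡n (offset m) i ⟩
      i ∎
      where
      open ≡-Reasoning
      n = rev m (offset m + i) + q * 2 ^ m
      r : rev m n ≡ offset m + i
      r = rev-rev m q (<-≤-trans (+-monoʳ-< (offset m) i<g) fits)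

    module _ (g-rec : Recursive (uncurry₁ g)) where

      offset-rec : Recursive (uncurry₁ offset)
      offset-rec = lam₁ (primRec (λ k _ → offset k) (const 0)
        (app₂ *-rec (const 2) (app₂ +-rec (var 1F) (app₁ g-rec (var 0F)))) λ _ _ → refl)

      level-rec : Recursive (uncurry₂ level)
      level-rec = lam₂ (primRec (λ k xs → level k (lookup xs 0F)) (const 0)
        (app₂ +-rec (var 1F) (app₂ ∸-rec (const 1)
          (app₂ ∸-rec (app₂ +-rec (app₁ offset-rec (var 1F)) (app₁ g-rec (var 1F)))
                      (app₂ rev-rec (var 1F) (var 2F))))) λ _ _ → refl)

      owner-rec : Recursive (uncurry₁ owner)
      owner-rec = lam₁ (app₂ ∸-rec (app₂ rev-rec lev (var 0F)) (app₁ offset-rec lev))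
        where lev = app₂ level-rec (var 0F) (var 0F)

  -- This is ⌊x / (d + 1)⌋, computed by a counter that rises whenever the next multiple of `suc d`
  -- is reached.
  quot : ℕ → ℕ → ℕ
  quot zero    d = 0
  quot (suc x) d = quot x d + (1 ∸ (suc (quot x d) * suc d ∸ suc x))

  quot-bounds : ∀ x d → quot x d * suc d ≤ x × x < suc (quot x d) * suc d
  quot-bounds zero    d = z≤n , s≤s z≤n
  quot-bounds (suc x) d with quot-bounds x d | suc (quot x d) * suc d ≤? suc x
  ... | lo , hi | yes le rewrite m≤n⇒m∸n≡0 le | +-comm (quot x d) 1 =
    le , ≤-<-trans hi (m<n+m (suc (quot x d) * suc d) (s≤s z≤n))
  ... | lo , hi | no ≰ rewrite m≤n⇒m∸n≡0 (m<n⇒0<n∸m (≰⇒> ≰)) | +-identityʳ (quot x d) =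
    m≤n⇒m≤1+n lo , ≰⇒> ≰

  quot-rec : Recursive (uncurry₂ quot)
  quot-rec = lam₂ (primRec (λ k xs → quot k (lookup xs 0F)) (const 0)
    (app₂ +-rec (var 1F) (app₂ ∸-rec (const 1) (app₂ ∸-rec
      (app₂ *-rec (app₁ suc-rec (var 1F)) (app₁ suc-rec (var 2F))) (app₁ suc-rec (var 0F))))) λ _ _ → refl)

open Allocations

module Machines where

  open import Data.Nat using (pred; _+_; _*_; _∸_; _≤_; _<_)
  open import Data.Nat.Properties
  open import Data.Nat.Solver using (module +-*-Solver)

  -- Strings as numbers, self-delimiting headers and the decoding machine.

  bit : Bool → ℕ
  bit b = if b then 1 else 0

  code-∷ : ∀ b σ → code (b ∷ σ) ≡ suc (bit b) + 2 * code σ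
  code-∷ false σ = refl
  code-∷ true  σ = refl

  code-∷ʳ : ∀ σ b → code (σ ∷ʳ b) ≡ code σ + 2 ^ length σ * suc (bit b)
  code-∷ʳ []      false = refl
  code-∷ʳ []      true  = refl
  code-∷ʳ (a ∷ σ) b = begin
    code (a ∷ σ ∷ʳ b)                     ≡⟨ code-∷ a (σ ∷ʳ b) ⟩
    suc (bit a) + 2 * code (σ ∷ʳ b)       ≡⟨ cong (λ c → suc (bit a) + 2 * c) (code-∷ʳ σ b) ⟩
    suc (bit a) + 2 * (code σ + 2 ^ length σ * suc (bit b))
      ≡⟨ solve 4 (λ x c p y → x :+ con 2 :* (c :+ p :* y) := x :+ con 2 :* c :+ con 2 :* p :* y)
           refl (suc (bit a)) (code σ) (2 ^ length σ) (suc (bit b)) ⟩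
    suc (bit a) + 2 * code σ + 2 ^ suc (length σ) * suc (bit b)
      ≡⟨ cong (_+ 2 ^ suc (length σ) * suc (bit b)) (code-∷ a σ) ⟨
    code (a ∷ σ) + 2 ^ suc (length σ) * suc (bit b) ∎
    where
    open ≡-Reasoning
    open +-*-Solver

  increment : List Bool → List Bool
  increment []          = false ∷ []
  increment (false ∷ σ) = true ∷ σ
  increment (true ∷ σ)  = false ∷ increment σ

  code-increment : ∀ σ → code (increment σ) ≡ suc (code σ)
  code-increment []          = refl
  code-increment (false ∷ σ) = refl
  code-increment (true ∷ σ) rewrite code-increment σ = m+2*[1+n] 1 (code σ)

  code-surjective : ∀ n → ∃[ σ ] (code σ ≡ n)
  code-surjective zero    = [] , refl
  code-surjective (suc n) = let (σ , eq) = code-surjective n in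
    increment σ , trans (code-increment σ) (cong suc eq)

  length≤code : ∀ σ → length σ ≤ code σ
  length≤code []          = z≤n
  length≤code (b ∷ σ) rewrite code-∷ b σ =
    s≤s (≤-trans (length≤code σ) (≤-trans (m≤m+n (code σ) _) (m≤n+m (2 * code σ) (bit b))))

  code<2^ : ∀ σ → suc (code σ) < 2 ^ suc (length σ)
  code<2^ []      = s≤s (s≤s z≤n)
  code<2^ (b ∷ σ) = begin
    suc (suc (code (b ∷ σ)))      ≤⟨ +-monoʳ-≤ 2 (bound b) ⟩
    2 + (2 + 2 * code σ)          ≡⟨ solve 1 (λ c → con 2 :+ (con 2 :+ con 2 :* c) := con 2 :* (con 2 :+ c)) refl (code σ) ⟩
    2 * suc (suc (code σ))        ≤⟨ *-monoʳ-≤ 2 (code<2^ σ) ⟩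
    2 ^ suc (length (b ∷ σ)) ∎
    where
    open ≤-Reasoning
    open +-*-Solver
    bound : ∀ b → code (b ∷ σ) ≤ 2 + 2 * code σ
    bound false = n≤1+n _
    bound true  = ≤-refl

  -- The codes of the strings of length m form a complete system of residues mod 2^m.
  align : ∀ m s → ∃[ β ] (length β ≡ m × ∃[ q ] (s + code β ≡ q * 2 ^ m))
  align zero    s = [] , refl , s , trans (+-identityʳ s) (sym (*-identityʳ s))
  -- The first digit of β is 2 for even s and 1 for odd s. Either way the sum is twice
  -- `suc (half s)`, which the remaining digits have to complete.
  align (suc m) s with align m (suc (half s)) | parity s | parity≤1 s | parity+2*half s
  ... | β , |β| , q , eq | zero | _ | s≡ = true ∷ β , cong suc |β| , q , (begin
    s + (2 + 2 * code β)                 ≡⟨ cong (_+ (2 + 2 * code β)) s≡ ⟨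
    2 * half s + (2 + 2 * code β)        ≡⟨ solve 2 (λ h c → con 2 :* h :+ (con 2 :+ con 2 :* c)
                                              := con 2 :* (con 1 :+ h :+ c)) refl (half s) (code β) ⟩
    2 * (suc (half s) + code β)          ≡⟨ cong (2 *_) eq ⟩
    2 * (q * 2 ^ m)                      ≡⟨ solve 2 (λ q p → con 2 :* (q :* p) := q :* (con 2 :* p)) refl q (2 ^ m) ⟩
    q * 2 ^ suc m ∎)
    where
    open ≡-Reasoning
    open +-*-Solver
  ... | β , |β| , q , eq | suc zero | _ | s≡ = false ∷ β , cong suc |β| , q , (begin
    s + (1 + 2 * code β)                 ≡⟨ cong (_+ (1 + 2 * code β)) s≡ ⟨
    1 + 2 * half s + (1 + 2 * code β)    ≡⟨ solve 2 (λ h c → con 1 :+ con 2 :* h :+ (con 1 :+ con 2 :* c)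
                                              := con 2 :* (con 1 :+ h :+ c)) refl (half s) (code β) ⟩
    2 * (suc (half s) + code β)          ≡⟨ cong (2 *_) eq ⟩
    2 * (q * 2 ^ m)                      ≡⟨ solve 2 (λ q p → con 2 :* (q :* p) := q :* (con 2 :* p)) refl q (2 ^ m) ⟩
    q * 2 ^ suc m ∎)
    where
    open ≡-Reasoning
    open +-*-Solver
  ... | _ | suc (suc _) | s≤s () | _

  -- This is `drop k` on codes: c is half the predecessor of both 1 + 2 c and 2 + 2 c, and 0 stays
  -- 0.
  tails : ℕ → ℕ → ℕ
  tails zero    t = t
  tails (suc k) t = half (pred (tails k t))

  tails-+ : ∀ j k t → tails (j + k) t ≡ tails j (tails k t)
  tails-+ zero    k t = refl
  tails-+ (suc j) k t = cong (half ∘ pred) (tails-+ j k t)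

  tails-suc : ∀ k t → tails (suc k) t ≡ tails k (tails 1 t)
  tails-suc k t = trans (cong (λ j → tails j t) (+-comm 1 k)) (tails-+ k 1 t)

  tails-1-code : ∀ b σ → tails 1 (code (b ∷ σ)) ≡ code σ
  tails-1-code false σ = half-+2* 0 (code σ)
  tails-1-code true  σ = half-+2* 1 (code σ)

  tails-code : ∀ k σ → tails k (code σ) ≡ code (drop k σ)
  tails-code zero    σ       = refl
  tails-code (suc k) []      = trans (tails-suc k 0) (trans (tails-code k []) (cong code (drop-[] k)))
  tails-code (suc k) (b ∷ σ) =
    trans (tails-suc k _) (trans (cong (tails k) (tails-1-code b σ)) (tails-code k σ))

  digit : ℕ → ℕ
  digit t = 2 ∸ parity t

  digit-code : ∀ b σ → digit (code (b ∷ σ)) ≡ suc (bit b)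
  digit-code false σ = cong (2 ∸_) (parity-+2* 1 (code σ))
  digit-code true  σ = cong (2 ∸_) (parity-+2* 2 (code σ))

  drop-applyUpTo : ∀ {A : Set} (h : ℕ → A) j d → drop j (applyUpTo h (j + d)) ≡ applyUpTo (h ∘ (j +_)) d
  drop-applyUpTo h zero    d = refl
  drop-applyUpTo h (suc j) d = drop-applyUpTo (h ∘ suc) j d

  digit-applyUpTo : ∀ h {n j} → j < n → digit (tails j (code (applyUpTo h n))) ≡ suc (bit (h j))
  digit-applyUpTo h {n} {j} j<n = begin
    digit (tails j (code (applyUpTo h n)))         ≡⟨ cong digit (tails-code j (applyUpTo h n)) ⟩
    digit (code (drop j (applyUpTo h n)))          ≡⟨ cong (λ x → digit (code (drop j (applyUpTo h x)))) n≡ ⟩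
    digit (code (drop j (applyUpTo h (j + suc d)))) ≡⟨ cong (digit ∘ code) (drop-applyUpTo h j (suc d)) ⟩
    digit (code (applyUpTo (h ∘ (j +_)) (suc d)))  ≡⟨ digit-code (h (j + 0)) _ ⟩
    suc (bit (h (j + 0)))                          ≡⟨ cong (λ x → suc (bit (h x))) (+-identityʳ j) ⟩
    suc (bit (h j)) ∎
    where
    open ≡-Reasoning
    d = n ∸ suc j
    n≡ : n ≡ j + suc d
    n≡ = trans (sym (m+[n∸m]≡n j<n)) (sym (+-suc j d))

  -- A header carries a string β as 1 β₀ 1 β₁ … 1 βₘ₋₁ 0.
  header : List Bool → List Bool
  header []      = false ∷ []
  header (b ∷ β) = true ∷ b ∷ header β

  length-header : ∀ β → length (header β) ≡ suc (2 * length β)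
  length-header []      = refl
  length-header (b ∷ β) = trans (cong (2 +_) (length-header β)) (sym (m+2*[1+n] 1 (length β)))

  readHeader : ℕ → ℕ → ℕ
  readHeader zero    s = 0
  readHeader (suc k) s = readHeader k s + 2 ^ k * digit (tails (suc (2 * k)) s)

  tails-2*suc : ∀ k s → tails (2 * suc k) s ≡ tails (2 * k) (tails 2 s)
  tails-2*suc k s = trans (cong (λ j → tails j s) (trans (m+2*[1+n] 0 k) (+-comm 2 (2 * k))))
    (tails-+ (2 * k) 2 s)

  -- The recursion in `readHeader` adds digits at the far end, whereas `header` is built from the
  -- front; this turns it around.
  readHeader-suc : ∀ k s → readHeader (suc k) s ≡ digit (tails 1 s) + 2 * readHeader k (tails 2 s)
  readHeader-suc zero    s = refl
  readHeader-suc (suc k) s = begin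
    readHeader (suc k) s + 2 ^ suc k * digit (tails (suc (2 * suc k)) s)
      ≡⟨ cong₂ (λ x y → x + 2 ^ suc k * digit (half (pred y))) (readHeader-suc k s) (tails-2*suc k s) ⟩
    digit (tails 1 s) + 2 * readHeader k (tails 2 s) + 2 ^ suc k * d
      ≡⟨ solve 4 (λ a r p d → a :+ con 2 :* r :+ con 2 :* p :* d := a :+ con 2 :* (r :+ p :* d))
           refl (digit (tails 1 s)) (readHeader k (tails 2 s)) (2 ^ k) d ⟩
    digit (tails 1 s) + 2 * readHeader (suc k) (tails 2 s) ∎
    where
    open ≡-Reasoning
    open +-*-Solver
    d = digit (tails (suc (2 * k)) (tails 2 s))

  tails-2-code : ∀ a b σ → tails 2 (code (a ∷ b ∷ σ)) ≡ code σ
  tails-2-code a b σ = tails-code 2 (a ∷ b ∷ σ)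

  readHeader-header : ∀ β p → readHeader (length β) (code (header β ++ p)) ≡ code β
  readHeader-header []      p = refl
  readHeader-header (b ∷ β) p = begin
    readHeader (suc (length β)) (code (header (b ∷ β) ++ p))
      ≡⟨ readHeader-suc (length β) _ ⟩
    digit (tails 1 (code (true ∷ b ∷ header β ++ p)))
      + 2 * readHeader (length β) (tails 2 (code (true ∷ b ∷ header β ++ p)))
      ≡⟨ cong₂ (λ x y → digit x + 2 * readHeader (length β) y)
           (tails-1-code true (b ∷ header β ++ p)) (tails-2-code true b (header β ++ p)) ⟩
    digit (code (b ∷ header β ++ p)) + 2 * readHeader (length β) (code (header β ++ p))
      ≡⟨ cong₂ (λ x y → x + 2 * y) (digit-code b _) (readHeader-header β p) ⟩
    suc (bit b) + 2 * code β
      ≡⟨ code-∷ b β ⟨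
    code (b ∷ β) ∎
    where open ≡-Reasoning

  payload : ℕ → ℕ → ℕ
  payload m s = tails (suc (2 * m)) s

  payload-header : ∀ β p → payload (length β) (code (header β ++ p)) ≡ code p
  payload-header []      p = tails-1-code false p
  payload-header (b ∷ β) p = trans
    (cong (half ∘ pred) (trans (tails-2*suc (length β) _)
      (cong (tails (2 * length β)) (tails-2-code true b (header β ++ p)))))
    (payload-header β p)

  -- Zero exactly when a bit `false` stands at place 2 m. Beyond the end of the string the code is
  -- 0, which is even, so reading never stops there: a string without a complete header is outside
  -- the domain.
  pending : ℕ → ℕ → ℕ
  pending m s = 1 ∸ parity (tails (2 * m) s)

  record HeaderLength (s m : ℕ) : Set where
    field
      stops     : pending m s ≡ 0
      continues : ∀ j → j < m → pending j s ≡ 1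

  open HeaderLength

  headerLength-header : ∀ β p → HeaderLength (code (header β ++ p)) (length β)
  headerLength-header [] p .stops = cong (1 ∸_) (parity-+2* 1 (code p))
  headerLength-header [] p .continues _ ()
  headerLength-header (b ∷ β) p = λ where
      .stops                       → trans (shift (length β)) (ih .stops)
      .continues zero    _         → cong (1 ∸_) (parity-+2* 2 (code (b ∷ header β ++ p)))
      .continues (suc j) (s≤s j<m) → trans (shift j) (ih .continues j j<m)
    where
    ih = headerLength-header β p
    shift : ∀ j → pending (suc j) (code (true ∷ b ∷ header β ++ p)) ≡ pending j (code (header β ++ p))
    shift j = cong (λ t → 1 ∸ parity t) (trans (tails-2*suc j _)
      (cong (tails (2 * j)) (tails-2-code true b (header β ++ p))))

  parity-code-drop⇒< : ∀ k σ → 1 ∸ parity (code (drop k σ)) ≡ 0 → k < length σ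
  parity-code-drop⇒< zero    []      ()
  parity-code-drop⇒< zero    (_ ∷ _) _ = s≤s z≤n
  parity-code-drop⇒< (suc k) []      ()
  parity-code-drop⇒< (suc k) (_ ∷ σ) eq = s≤s (parity-code-drop⇒< k σ eq)

  drop-++-≤ : ∀ k (σ ρ : List Bool) → k ≤ length σ → drop k (σ ++ ρ) ≡ drop k σ ++ ρ
  drop-++-≤ zero    σ       ρ _         = refl
  drop-++-≤ (suc k) (_ ∷ σ) ρ (s≤s k≤l) = drop-++-≤ k σ ρ k≤l

  parity-code-++ : ∀ k σ ρ → k < length σ → parity (code (drop k (σ ++ ρ))) ≡ parity (code (drop k σ))
  parity-code-++ zero    (false ∷ σ) ρ _ = trans (parity-+2* 1 (code (σ ++ ρ))) (sym (parity-+2* 1 (code σ)))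
  parity-code-++ zero    (true ∷ σ)  ρ _ = trans (parity-+2* 2 (code (σ ++ ρ))) (sym (parity-+2* 2 (code σ)))
  parity-code-++ (suc k) (_ ∷ σ)     ρ (s≤s k<l) = parity-code-++ k σ ρ k<l

  headerLength-< : ∀ {m} σ → HeaderLength (code σ) m → 2 * m < length σ
  headerLength-< {m} σ h = parity-code-drop⇒< (2 * m) σ
    (trans (cong (λ t → 1 ∸ parity t) (sym (tails-code (2 * m) σ))) (h .stops))

  -- The stopping bit at place 2 m lies inside σ, hence so do all the bits inspected before it, and
  -- appending ρ changes none of them.
  headerLength-++ : ∀ {m} σ ρ → HeaderLength (code σ) m → HeaderLength (code (σ ++ ρ)) m
  headerLength-++ {m} σ ρ h = λ where
      .stops         → trans (same m (headerLength-< σ h)) (h .stops)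
      .continues j j<m → trans (same j (≤-<-trans (*-monoʳ-≤ 2 (<⇒≤ j<m)) (headerLength-< σ h)))
                               (h .continues j j<m)
    where
    same : ∀ j → 2 * j < length σ → pending j (code (σ ++ ρ)) ≡ pending j (code σ)
    same j lt = cong (1 ∸_) (trans (cong parity (tails-code (2 * j) (σ ++ ρ)))
      (trans (parity-code-++ (2 * j) σ ρ lt) (cong parity (sym (tails-code (2 * j) σ)))))

  tails-rec : Recursive (uncurry₂ tails)
  tails-rec = lam₂ (primRec (λ k xs → tails k (lookup xs 0F)) (var 0F)
    (app₁ half-rec (app₁ pred-rec (var 1F))) λ _ _ → refl)

  digit-rec : Recursive (uncurry₁ digit)
  digit-rec = lam₁ (app₂ ∸-rec (const 2) (app₁ parity-rec (var 0F)))

  readHeader-rec : Recursive (uncurry₂ readHeader)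
  readHeader-rec = lam₂ (primRec (λ k xs → readHeader k (lookup xs 0F)) (const 0)
    (app₂ +-rec (var 1F) (app₂ *-rec (app₁ 2^-rec (var 0F)) (app₁ digit-rec
      (app₂ tails-rec (app₁ suc-rec (app₂ *-rec (const 2) (var 0F))) (var 2F))))) λ _ _ → refl)

  payload-rec : Recursive (uncurry₂ payload)
  payload-rec = lam₂ (app₂ tails-rec (app₁ suc-rec (app₂ *-rec (const 2) (var 0F))) (var 1F))

  pending-rec : Recursive (uncurry₂ pending)
  pending-rec = lam₂ (app₂ ∸-rec (const 1) (app₁ parity-rec
    (app₂ tails-rec (app₂ *-rec (const 2) (var 0F)) (var 1F))))

  headerLengthProgram : Rec ⊥ 1
  headerLengthProgram = mu (program pending-rec)

  headerLength-⇓ : ∀ {s m} → HeaderLength s m → noOracle ⊢ headerLengthProgram ∙ s ∷ [] ⇓ m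
  headerLength-⇓ {s} {m} h = ⇓mu
    (⇓-value (h .stops) (correct pending-rec (m ∷ s ∷ [])))
    (λ j j<m → 0 , ⇓-value (h .continues j j<m) (correct pending-rec (j ∷ s ∷ [])))

  ⇓-headerLength : ∀ {s m} → noOracle ⊢ headerLengthProgram ∙ s ∷ [] ⇓ m → HeaderLength s m
  ⇓-headerLength {s} (⇓mu {k = m} p q) = λ where
    .stops           → ⇓-functional noOracle (correct pending-rec (m ∷ s ∷ [])) p
    .continues j j<m → let (v , r) = q j j<m in
      ≤-antisym (m∸n≤m 1 (parity (tails (2 * j) s)))
        (subst (1 ≤_) (sym (⇓-functional noOracle (correct pending-rec (j ∷ s ∷ [])) r)) (s≤s z≤n))

  module Machine (U : Rec ⊥ 1) (g : ℕ → ℕ) (g-rec : Recursive (uncurry₁ g)) where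

    open Allocation g

    -- An aligned block of length 2^m begins at place e of the string w. It has exactly one position
    -- in each class mod 2^m, at distance `rev m` of the rank from its beginning.
    extract : ℕ → ℕ → ℕ → ℕ → ℕ
    extract zero    m e w = 0
    extract (suc k) m e w = extract k m e w + 2 ^ k * digit (tails (e + rev m (offset m + k)) w)

    extractAll : ℕ → ℕ → ℕ → ℕ
    extractAll m e w = extract (g m) m e w

    extract-rec : Recursive (uncurry₄ extract)
    extract-rec = lam₄ (primRec (λ k xs → extract k (lookup xs 0F) (lookup xs 1F) (lookup xs 2F)) (const 0)
      (app₂ +-rec (var 1F) (app₂ *-rec (app₁ 2^-rec (var 0F)) (app₁ digit-rec
        (app₂ tails-rec (app₂ +-rec (var 3F)
          (app₂ rev-rec (var 2F) (app₂ +-rec (app₁ (offset-rec g-rec) (var 2F)) (var 0F))))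
          (var 4F))))) λ _ _ → refl)

    extractAll-rec : Recursive (uncurry₃ extractAll)
    extractAll-rec = lam₃ (app₄ extract-rec (app₁ g-rec (var 0F)) (var 0F) (var 1F) (var 2F))

    machine : Rec ⊥ 1
    machine = comp (program extractAll-rec)
      ( headerLengthProgram
      ∷ comp (program readHeader-rec) (headerLengthProgram ∷ proj 0F ∷ [])
      ∷ comp U (comp (program payload-rec) (headerLengthProgram ∷ proj 0F ∷ []) ∷ [])
      ∷ [])

    machine-⇓ : ∀ {s m w} → HeaderLength s m → noOracle ⊢ U ∙ payload m s ∷ [] ⇓ w →
                noOracle ⊢ machine ∙ s ∷ [] ⇓ extractAll m (readHeader m s) w
    machine-⇓ {s} {m} {w} h u = ⇓comp
      ( hl
      ∷ ⇓comp (hl ∷ ⇓proj 0F ∷ []) (correct readHeader-rec (m ∷ s ∷ []))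
      ∷ ⇓comp (⇓comp (hl ∷ ⇓proj 0F ∷ []) (correct payload-rec (m ∷ s ∷ [])) ∷ []) u
      ∷ []) (correct extractAll-rec (m ∷ readHeader m s ∷ w ∷ []))
      where hl = headerLength-⇓ h

    ⇓-machine : ∀ {s v} → noOracle ⊢ machine ∙ s ∷ [] ⇓ v →
                ∃[ m ] (HeaderLength s m × ∃[ w ] (noOracle ⊢ U ∙ payload m s ∷ [] ⇓ w))
    ⇓-machine {s} (⇓comp (_ ∷ _ ∷ ⇓comp (⇓comp {ys = m ∷ _ ∷ []} (p ∷ ⇓proj _ ∷ []) q ∷ []) u ∷ []) _) =
      m , ⇓-headerLength p , _ ,
      ⇓-argument (⇓-functional noOracle q (correct payload-rec (m ∷ s ∷ []))) u

    ⇓⇒Dom : ∀ {σ w} → noOracle ⊢ U ∙ code σ ∷ [] ⇓ w → Dom U σ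
    ⇓⇒Dom {w = w} u = let (τ , eq) = code-surjective w in τ , ⇓-value (sym eq) u

    -- Two comparable inputs in the domain have the same header, so their payloads are comparable
    -- members of the domain of U and therefore equal.
    machine-prefixFree : PrefixFree U → PrefixFree machine
    machine-prefixFree pf σ τ (_ , σ⇓) (_ , τ⇓) σ⊑τ with Prefix.toView σ⊑τ
    ... | σ≋ Prefix.++ ρ with refl ← Pointwise-≡⇒≡ σ≋ = go (⇓-machine σ⇓) (⇓-machine τ⇓)
      where
      go : ∃[ m ] (HeaderLength (code σ) m × ∃[ w ] (noOracle ⊢ U ∙ payload m (code σ) ∷ [] ⇓ w)) →
           ∃[ m ] (HeaderLength (code (σ ++ ρ)) m × ∃[ w ] (noOracle ⊢ U ∙ payload m (code (σ ++ ρ)) ∷ [] ⇓ w)) →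
           σ ≡ σ ++ ρ
      go (m , h , _ , u) (m′ , h′ , _ , u′)
        with refl ← ⇓-functional noOracle (headerLength-⇓ (headerLength-++ σ ρ h)) (headerLength-⇓ h′) =
        trans (sym (++-identityʳ σ)) (cong (σ ++_) (sym ρ≡[]))
        where
        k = suc (2 * m)
        drop-eq : drop k (σ ++ ρ) ≡ drop k σ ++ ρ
        drop-eq = drop-++-≤ k σ ρ (headerLength-< σ h)
        ρ≡[] : ρ ≡ []
        ρ≡[] = ++-identityʳ-unique (drop k σ) (pf (drop k σ) (drop k σ ++ ρ)
          (⇓⇒Dom {drop k σ} (⇓-argument (tails-code k σ) u))
          (⇓⇒Dom {drop k σ ++ ρ} (⇓-argument
            (trans (tails-code k (σ ++ ρ)) (cong code drop-eq)) u′))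
          (Prefix.fromView (Pointwise.refl refl Prefix.++ ρ)))

    machine-extracts : ∀ (X : ℕ → Bool) β p {start n} q →
      offset (length β) + g (length β) ≤ 2 ^ length β →
      start + code β ≡ q * 2 ^ length β → 2 ^ (2 + length β) ≤ n →
      U ⟪ p ⟫≃ applyUpTo (λ j → X (owner (start + j))) n →
      machine ⟪ header β ++ p ⟫≃ (X ↾ g (length β))
    machine-extracts X β p {start} {n} q fits aligned long u =
      ⇓-value
        (trans (cong (λ e → extractAll m e (code υ)) (readHeader-header β p)) (extract-code (g m) ≤-refl))
        (machine-⇓ (headerLength-header β p)
          (⇓-argument (sym (payload-header β p)) u))
      where
      m = length β
      υ = applyUpTo (λ j → X (owner (start + j))) n

      class : ℕ → ℕ
      class k = rev m (offset m + k)

      position : ∀ k → start + (code β + class k) ≡ class k + q * 2 ^ m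
      position k = trans (sym (+-assoc start (code β) (class k)))
        (trans (cong (_+ class k) aligned) (+-comm (q * 2 ^ m) (class k)))

      -- The block starts below 2^(m+1) and has length 2^m, so 2^(m+2) bits are enough to contain
      -- it.
      inside : ∀ k → code β + class k < n
      inside k = <-≤-trans (+-mono-<-≤ (<⇒≤ (code<2^ β))
                   (≤-trans (<⇒≤ (rev<2^ m (offset m + k))) (m≤m+n (2 ^ m) _)))
                 (≤-trans (≤-reflexive (cong (2 ^ suc m +_) (sym (+-identityʳ (2 ^ suc m))))) long)

      -- The block begins at `start + code β`, and a code is at least the length of its string; so
      -- every position read satisfies the proviso n ≥ m of `owner`.
      far : ∀ k → m ≤ class k + q * 2 ^ m
      far k = ≤-trans (length≤code β) (≤-trans (m≤n+m (code β) start)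
        (≤-trans (≤-reflexive aligned) (m≤n+m (q * 2 ^ m) (class k))))

      extract-code : ∀ k → k ≤ g m → extract k m (code β) (code υ) ≡ code (X ↾ k)
      extract-code zero    _   = refl
      extract-code (suc k) k<g = begin
        extract k m (code β) (code υ) + 2 ^ k * digit (tails (code β + class k) (code υ))
          ≡⟨ cong₂ (λ x y → x + 2 ^ k * y) (extract-code k (<⇒≤ k<g))
               (digit-applyUpTo _ (inside k)) ⟩
        code (X ↾ k) + 2 ^ k * suc (bit (X (owner (start + (code β + class k)))))
          ≡⟨ cong (λ j → code (X ↾ k) + 2 ^ k * suc (bit (X j)))
               (trans (cong owner (position k)) (owner-class q fits k<g (far k))) ⟩
        code (X ↾ k) + 2 ^ k * suc (bit (X k))
          ≡⟨ cong (λ l → code (X ↾ k) + 2 ^ l * suc (bit (X k))) (length-applyUpTo X k) ⟨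
        code (X ↾ k) + 2 ^ length (X ↾ k) * suc (bit (X k))
          ≡⟨ code-∷ʳ (X ↾ k) (X k) ⟨
        code ((X ↾ k) ∷ʳ X k)
          ≡⟨ cong code (applyUpTo-∷ʳ X k) ⟩
        code (X ↾ suc k) ∎
        where open ≡-Reasoning

open Machines

open import Data.Integer using (+_; +[1+_]; _⊖_)
open import Data.Rational using (_<_; _≤_)
open import Data.Rational.Solver using (module +-*-Solver)

-- Naturals and powers of two among the rationals.

ι : ℕ → ℚ
ι n = + n ℚ./ 1

toℚᵘ-/ : ∀ i d → toℚᵘ (i ℚ./ suc d) ℚᵘ.≃ ℚᵘ.mkℚᵘ i d
toℚᵘ-/ i d = ℚₚ.toℚᵘ-fromℚᵘ (ℚᵘ.mkℚᵘ i d)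

ι-+ : ∀ m n → ι (m ℕ.+ n) ≡ ι m ℚ.+ ι n
ι-+ m n = ℚₚ.toℚᵘ-injective (begin
  toℚᵘ (ι (m ℕ.+ n))                       ≈⟨ toℚᵘ-/ (+ (m ℕ.+ n)) 0 ⟩
  ℚᵘ.mkℚᵘ (+ (m ℕ.+ n)) 0                  ≈⟨ ℚᵘ.*≡* (cong (ℤ._* + 1)
                                                (cong₂ ℤ._+_ (sym (ℤₚ.*-identityʳ (+ m))) (sym (ℤₚ.*-identityʳ (+ n))))) ⟩
  ℚᵘ.mkℚᵘ (+ m) 0 ℚᵘ.+ ℚᵘ.mkℚᵘ (+ n) 0     ≈⟨ ℚᵘₚ.+-cong (toℚᵘ-/ (+ m) 0) (toℚᵘ-/ (+ n) 0) ⟨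
  toℚᵘ (ι m) ℚᵘ.+ toℚᵘ (ι n)               ≈⟨ ℚₚ.toℚᵘ-homo-+ (ι m) (ι n) ⟨
  toℚᵘ (ι m ℚ.+ ι n) ∎)
  where open ℚᵘₚ.≃-Reasoning

ι-* : ∀ m n → ι (m ℕ.* n) ≡ ι m ℚ.* ι n
ι-* m n = ℚₚ.toℚᵘ-injective (begin
  toℚᵘ (ι (m ℕ.* n))                       ≈⟨ toℚᵘ-/ (+ (m ℕ.* n)) 0 ⟩
  ℚᵘ.mkℚᵘ (+ (m ℕ.* n)) 0                  ≈⟨ ℚᵘ.*≡* (cong (ℤ._* + 1) (ℤₚ.pos-* m n)) ⟩
  ℚᵘ.mkℚᵘ (+ m) 0 ℚᵘ.* ℚᵘ.mkℚᵘ (+ n) 0     ≈⟨ ℚᵘₚ.*-cong (toℚᵘ-/ (+ m) 0) (toℚᵘ-/ (+ n) 0) ⟨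
  toℚᵘ (ι m) ℚᵘ.* toℚᵘ (ι n)               ≈⟨ ℚₚ.toℚᵘ-homo-* (ι m) (ι n) ⟨
  toℚᵘ (ι m ℚ.* ι n) ∎)
  where open ℚᵘₚ.≃-Reasoning

/-mono-≤ : ∀ i j d e → i ℤ.* + suc e ℤ.≤ j ℤ.* + suc d → i ℚ./ suc d ℚ.≤ j ℚ./ suc e
/-mono-≤ i j d e le = ℚₚ.toℚᵘ-cancel-≤ (begin
  toℚᵘ (i ℚ./ suc d)   ≃⟨ toℚᵘ-/ i d ⟩
  ℚᵘ.mkℚᵘ i d          ≤⟨ ℚᵘ.*≤* le ⟩
  ℚᵘ.mkℚᵘ j e          ≃⟨ toℚᵘ-/ j e ⟨
  toℚᵘ (j ℚ./ suc e) ∎)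
  where open ℚᵘₚ.≤-Reasoning

ι-mono-≤ : ∀ {m n} → m ℕ.≤ n → ι m ℚ.≤ ι n
ι-mono-≤ {m} {n} m≤n = /-mono-≤ (+ m) (+ n) 0 0 (ℤₚ.*-monoʳ-≤-nonNeg (+ 1) (ℤ.+≤+ m≤n))

ι-cancel-≤ : ∀ {m n} → ι m ℚ.≤ ι n → m ℕ.≤ n
ι-cancel-≤ {m} {n} le with ℚᵘₚ.≤-respˡ-≃ (toℚᵘ-/ (+ m) 0)
  (ℚᵘₚ.≤-respʳ-≃ (toℚᵘ-/ (+ n) 0) (ℚₚ.toℚᵘ-mono-≤ le))
... | ℚᵘ.*≤* le′ = ℤₚ.drop‿+≤+ (ℤₚ.*-cancelʳ-≤-pos (+ m) (+ n) (+ 1) le′)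

ι-nonNegative : ∀ n → ℚ.NonNegative (ι n)
ι-nonNegative n = ℚₚ.normalize-nonNeg n 1

2^-positive : ∀ k → ℚ.Positive (2^- k)
2^-positive k = ℚₚ.normalize-pos 1 (2 ^ k) {{ℕₚ.m^n≢0 2 k}}

2^-nonNegative : ∀ k → ℚ.NonNegative (2^- k)
2^-nonNegative k = ℚₚ.pos⇒nonNeg (2^- k) {{2^-positive k}}

2^-inverse : ∀ k → ι (2 ^ k) ℚ.* 2^- k ≡ 1ℚ
2^-inverse k with 2 ^ k | ℕₚ.m^n≢0 2 k
... | suc d | _ = ℚₚ.toℚᵘ-injective (begin
  toℚᵘ (ι (suc d) ℚ.* (+ 1 ℚ./ suc d))            ≈⟨ ℚₚ.toℚᵘ-homo-* (ι (suc d)) _ ⟩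
  toℚᵘ (ι (suc d)) ℚᵘ.* toℚᵘ (+ 1 ℚ./ suc d)      ≈⟨ ℚᵘₚ.*-cong (toℚᵘ-/ (+ suc d) 0) (toℚᵘ-/ (+ 1) d) ⟩
  ℚᵘ.mkℚᵘ (+ suc d) 0 ℚᵘ.* ℚᵘ.mkℚᵘ (+ 1) d        ≈⟨ ℚᵘ.*≡* (cross d) ⟩
  toℚᵘ 1ℚ ∎)
  where
  open ℚᵘₚ.≃-Reasoning
  cross : ∀ d → (+ suc d ℤ.* + 1) ℤ.* + 1 ≡ + 1 ℤ.* + (suc d ℕ.+ 0)
  cross d = trans (ℤₚ.*-identityʳ _) (trans (ℤₚ.*-identityʳ (+ suc d))
    (trans (cong +_ (sym (ℕₚ.+-identityʳ (suc d)))) (sym (ℤₚ.*-identityˡ _))))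

*2^-≤ : ∀ x e a → x ℕ.* 2 ^ e ℕ.≤ 2 ^ a → ι x ℚ.* 2^- a ℚ.≤ 2^- e
*2^-≤ x e a le = begin
  ι x ℚ.* 2^- a                            ≡⟨ ℚₚ.*-identityʳ (ι x ℚ.* 2^- a) ⟨
  ι x ℚ.* 2^- a ℚ.* 1ℚ                     ≡⟨ cong (ι x ℚ.* 2^- a ℚ.*_) (2^-inverse e) ⟨
  ι x ℚ.* 2^- a ℚ.* (ι (2 ^ e) ℚ.* 2^- e)  ≡⟨ solve 4 (λ x y z w → x :* y :* (z :* w) := x :* z :* (y :* w))
                                                refl (ι x) (2^- a) (ι (2 ^ e)) (2^- e) ⟩
  ι x ℚ.* ι (2 ^ e) ℚ.* r                  ≡⟨ cong (ℚ._* r) (ι-* x (2 ^ e)) ⟨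
  ι (x ℕ.* 2 ^ e) ℚ.* r                    ≤⟨ ℚₚ.*-monoʳ-≤-nonNeg r {{r≥0}} (ι-mono-≤ le) ⟩
  ι (2 ^ a) ℚ.* r                          ≡⟨ ℚₚ.*-assoc (ι (2 ^ a)) (2^- a) (2^- e) ⟨
  ι (2 ^ a) ℚ.* 2^- a ℚ.* 2^- e            ≡⟨ cong (ℚ._* 2^- e) (2^-inverse a) ⟩
  1ℚ ℚ.* 2^- e                             ≡⟨ ℚₚ.*-identityˡ (2^- e) ⟩
  2^- e ∎
  where
  open ℚₚ.≤-Reasoning
  open +-*-Solver
  r = 2^- a ℚ.* 2^- e
  r≥0 = ℚₚ.pos⇒nonNeg r {{ℚₚ.pos*pos⇒pos (2^- a) {{2^-positive a}} (2^- e) {{2^-positive e}}}}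

-- The order of the Cauchy reals.

½-positive : ∀ {ε} → 0ℚ ℚ.< ε → 0ℚ ℚ.< ½ ℚ.* ε
½-positive {ε} 0<ε = subst (ℚ._< ½ ℚ.* ε) (ℚₚ.*-zeroʳ ½) (ℚₚ.*-monoʳ-<-pos ½ 0<ε)

½+½ : ∀ ε → ½ ℚ.* ε ℚ.+ ½ ℚ.* ε ≡ ε
½+½ ε = trans (sym (ℚₚ.*-distribʳ-+ ε ½ ½)) (ℚₚ.*-identityˡ ε)

≤ᵣ-pointwise : ∀ {x y} → (∀ n → approx x n ℚ.≤ approx y n) → x ≤ᵣ y
≤ᵣ-pointwise {x} {y} le ε 0<ε = 0 , λ n _ → ℚₚ.≤-trans (le n)
  (subst (ℚ._≤ approx y n ℚ.+ ε) (ℚₚ.+-identityʳ (approx y n)) (ℚₚ.+-monoʳ-≤ (approx y n) (ℚₚ.<⇒≤ 0<ε)))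

≤ᵣ-pointwise-≡ : ∀ {x y} → (∀ n → approx x n ≡ approx y n) → x ≤ᵣ y
≤ᵣ-pointwise-≡ {x} {y} eq = ≤ᵣ-pointwise {x} {y} (ℚₚ.≤-reflexive ∘ eq)

≤ᵣ-refl : ∀ {x} → x ≤ᵣ x
≤ᵣ-refl {x} = ≤ᵣ-pointwise-≡ {x} {x} λ _ → refl

≤ᵣ-trans : ∀ {x y z} → x ≤ᵣ y → y ≤ᵣ z → x ≤ᵣ z
≤ᵣ-trans {x} {y} {z} x≤y y≤z ε 0<ε =
  let (M , p) = x≤y (½ ℚ.* ε) (½-positive 0<ε)
      (N , q) = y≤z (½ ℚ.* ε) (½-positive 0<ε)
  in M ℕ.⊔ N , λ n le → begin
    approx x n                              ≤⟨ p n (ℕₚ.m⊔n≤o⇒m≤o M N le) ⟩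
    approx y n ℚ.+ ½ ℚ.* ε                  ≤⟨ ℚₚ.+-monoˡ-≤ (½ ℚ.* ε) (q n (ℕₚ.m⊔n≤o⇒n≤o M N le)) ⟩
    approx z n ℚ.+ ½ ℚ.* ε ℚ.+ ½ ℚ.* ε      ≡⟨ ℚₚ.+-assoc (approx z n) _ _ ⟩
    approx z n ℚ.+ (½ ℚ.* ε ℚ.+ ½ ℚ.* ε)    ≡⟨ cong (approx z n ℚ.+_) (½+½ ε) ⟩
    approx z n ℚ.+ ε ∎
  where open ℚₚ.≤-Reasoning

+ᵣ-mono-≤ᵣ : ∀ {x y u v} → x ≤ᵣ y → u ≤ᵣ v → x +ᵣ u ≤ᵣ y +ᵣ v
+ᵣ-mono-≤ᵣ {x} {y} {u} {v} x≤y u≤v ε 0<ε =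
  let (M , p) = x≤y (½ ℚ.* ε) (½-positive 0<ε)
      (N , q) = u≤v (½ ℚ.* ε) (½-positive 0<ε)
  in M ℕ.⊔ N , λ n le → begin
    approx x n ℚ.+ approx u n
      ≤⟨ ℚₚ.+-mono-≤ (p n (ℕₚ.m⊔n≤o⇒m≤o M N le)) (q n (ℕₚ.m⊔n≤o⇒n≤o M N le)) ⟩
    (approx y n ℚ.+ ½ ℚ.* ε) ℚ.+ (approx v n ℚ.+ ½ ℚ.* ε)
      ≡⟨ solve 3 (λ a b h → (a :+ h) :+ (b :+ h) := (a :+ b) :+ (h :+ h)) refl
           (approx y n) (approx v n) (½ ℚ.* ε) ⟩
    (approx y n ℚ.+ approx v n) ℚ.+ (½ ℚ.* ε ℚ.+ ½ ℚ.* ε)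
      ≡⟨ cong ((approx y n ℚ.+ approx v n) ℚ.+_) (½+½ ε) ⟩
    approx y n ℚ.+ approx v n ℚ.+ ε ∎
  where
  open ℚₚ.≤-Reasoning
  open +-*-Solver

·ᵣ-mono-≤ᵣ : ∀ q .{{_ : ℚ.Positive q}} {x y} → x ≤ᵣ y → q ·ᵣ x ≤ᵣ q ·ᵣ y
·ᵣ-mono-≤ᵣ q {x} {y} x≤y ε 0<ε =
  let (N , p) = x≤y (ℚ.1/ q ℚ.* ε) (ℚₚ.positive⁻¹ _ {{ℚₚ.pos*pos⇒pos (ℚ.1/ q) ε}})
  in N , λ n le → begin
    q ℚ.* approx x n                             ≤⟨ ℚₚ.*-monoˡ-≤-nonNeg q (p n le) ⟩
    q ℚ.* (approx y n ℚ.+ ℚ.1/ q ℚ.* ε)          ≡⟨ solve 4 (λ q y r e → q :* (y :+ r :* e) := q :* y :+ q :* r :* e)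
                                                      refl q (approx y n) (ℚ.1/ q) ε ⟩
    q ℚ.* approx y n ℚ.+ q ℚ.* ℚ.1/ q ℚ.* ε      ≡⟨ cong (λ r → q ℚ.* approx y n ℚ.+ r ℚ.* ε) (ℚₚ.*-inverseʳ q) ⟩
    q ℚ.* approx y n ℚ.+ 1ℚ ℚ.* ε                ≡⟨ cong (q ℚ.* approx y n ℚ.+_) (ℚₚ.*-identityˡ ε) ⟩
    q ℚ.* approx y n ℚ.+ ε ∎
  where
  open ℚₚ.≤-Reasoning
  open +-*-Solver
  instance
    _ = ℚₚ.pos⇒nonZero q
    _ = ℚₚ.pos⇒nonNeg q
    _ = ℚₚ.1/pos⇒pos q
    _ = ℚ.positive 0<ε

fromℚ-mono : ∀ {p q} → p ℚ.≤ q → fromℚ p ≤ᵣ fromℚ q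
fromℚ-mono {p} {q} p≤q = ≤ᵣ-pointwise {fromℚ p} {fromℚ q} λ _ → p≤q

fromℚ-cancel : ∀ {p q} → fromℚ p ≤ᵣ fromℚ q → p ℚ.≤ q
fromℚ-cancel {p} {q} le with p ℚ.≤? q
... | yes p≤q = p≤q
... | no  p≰q = ⊥-elim (below (ℚₚ.<-dense (ℚₚ.≰⇒> p≰q)))
  where
  below : ∃[ r ] (q ℚ.< r × r ℚ.< p) → ⊥
  below (r , q<r , r<p) =
    let (N , le′) = le (r ℚ.- q) (subst (ℚ._< r ℚ.- q) (ℚₚ.+-inverseʳ q) (ℚₚ.+-monoˡ-< (ℚ.- q) q<r))
    in ℚₚ.<-irrefl refl (ℚₚ.<-≤-trans r<p
         (subst (p ℚ.≤_) (solve 2 (λ q r → q :+ (r :- q) := r) refl q r) (le′ N ℕₚ.≤-refl)))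
    where open +-*-Solver

-ᵣ-≤ᵣ⇒≤ᵣ-+ᵣ : ∀ {x y z} → x -ᵣ y ≤ᵣ z → x ≤ᵣ z +ᵣ y
-ᵣ-≤ᵣ⇒≤ᵣ-+ᵣ {x} {y} {z} le = ≤ᵣ-trans {x} {(x -ᵣ y) +ᵣ y} {z +ᵣ y}
  (≤ᵣ-pointwise-≡ {x} {(x -ᵣ y) +ᵣ y} λ n →
    solve 2 (λ x y → x := x :+ con (ℚ.- 1ℚ) :* y :+ y) refl (approx x n) (approx y n))
  (+ᵣ-mono-≤ᵣ {x -ᵣ y} {z} {y} {y} le (≤ᵣ-refl {y}))
  where open +-*-Solver

-- Recursive integer bounds for a computable function.

/≤1+quot : ∀ a b d → (a ⊖ b) ℚ./ suc d ℚ.≤ ι (suc (quot (a ℕ.∸ b) d))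
/≤1+quot a b d = /-mono-≤ (a ⊖ b) (+ suc q) d 0
  (subst₂ ℤ._≤_ (sym (ℤₚ.*-identityʳ (a ⊖ b))) (ℤₚ.pos-* (suc q) (suc d)) ⊖≤)
  where
  q = quot (a ℕ.∸ b) d
  ⊖≤ : a ⊖ b ℤ.≤ + (suc q ℕ.* suc d)
  ⊖≤ with ℕₚ.≤-total b a
  ... | inj₁ b≤a = subst (ℤ._≤ + (suc q ℕ.* suc d)) (sym (ℤₚ.⊖-≥ b≤a))
                     (ℤ.+≤+ (ℕₚ.<⇒≤ (proj₂ (quot-bounds (a ℕ.∸ b) d))))
  ... | inj₂ a≤b = ℤₚ.≤-trans (ℤₚ.⊖-monoˡ-≤ b a≤b)
                     (subst (ℤ._≤ + (suc q ℕ.* suc d)) (sym (ℤₚ.n⊖n≡0 b)) (ℤ.+≤+ z≤n))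

quot≤/ : ∀ {a b} d → b ℕ.≤ a → ι (quot (a ℕ.∸ b) d) ℚ.≤ (a ⊖ b) ℚ./ suc d
quot≤/ {a} {b} d b≤a = /-mono-≤ (+ q) (a ⊖ b) 0 d
  (subst₂ ℤ._≤_ (ℤₚ.pos-* q (suc d)) (trans (sym (ℤₚ.⊖-≥ b≤a)) (sym (ℤₚ.*-identityʳ (a ⊖ b))))
    (ℤ.+≤+ (proj₁ (quot-bounds (a ℕ.∸ b) d))))
  where q = quot (a ℕ.∸ b) d

-- The floor of a computable real cannot be computed uniformly, so an integer bound with some slack
-- takes its place.
record NaturalBound (f : ℕ → ℝ) : Set where
  field
    bound     : ℕ → ℕ
    recursive : Recursive (uncurry₁ bound)
    above     : ∀ n → f n ≤ᵣ fromℕ (bound n)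
    near      : ∀ n → fromℕ (bound n) ≤ᵣ f n +ᵣ fromℕ 3

naturalBound : ∀ {f} → (∀ n → 0ℝ ≤ᵣ f n) → Computable f → NaturalBound f
naturalBound {f} 0≤f (a , b , d , a-rec , b-rec , d-rec , close) = record
  -- With r the approximation of precision 2^0, the 2 makes up for the error 1 of r and for rounding
  -- r down; from above, `Q n` + 2 ≤ r + 2 ≤ f n + 3.
  { bound     = λ n → Q n ℕ.+ 2
  ; recursive = lam₁ (app₂ +-rec (app₂ quot-rec (app₂ ∸-rec (at-0 a-rec) (at-0 b-rec)) (at-0 d-rec)) (const 2))
  ; above     = above
  ; near      = near
  }
  where
  at-0 : ∀ {h} → Recursive₂ h → Recursive {1} (λ xs → h (lookup xs 0F) 0)
  at-0 h-rec = app₂ (fromRecursive₂ h-rec) (var 0F) (const 0)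
  Q : ℕ → ℕ
  Q n = quot (a n 0 ℕ.∸ b n 0) (d n 0)
  r : ℕ → ℚ
  r n = (a n 0 ⊖ b n 0) ℚ./ suc (d n 0)

  above : ∀ n → f n ≤ᵣ fromℕ (Q n ℕ.+ 2)
  above n = ≤ᵣ-trans {f n} {fromℚ 1ℚ +ᵣ fromℚ (r n)} {fromℕ (Q n ℕ.+ 2)}
    (-ᵣ-≤ᵣ⇒≤ᵣ-+ᵣ {f n} {fromℚ (r n)} {fromℚ 1ℚ} (proj₂ (close n 0)))
    (≤ᵣ-pointwise {fromℚ 1ℚ +ᵣ fromℚ (r n)} {fromℕ (Q n ℕ.+ 2)} λ _ → begin
      1ℚ ℚ.+ r n                  ≤⟨ ℚₚ.+-monoʳ-≤ 1ℚ (/≤1+quot (a n 0) (b n 0) (d n 0)) ⟩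
      ι 1 ℚ.+ ι (suc (Q n))       ≡⟨ ι-+ 1 (suc (Q n)) ⟨
      ι (2 ℕ.+ Q n)               ≡⟨ cong ι (ℕₚ.+-comm 2 (Q n)) ⟩
      ι (Q n ℕ.+ 2) ∎)
    where open ℚₚ.≤-Reasoning

  near : ∀ n → fromℕ (Q n ℕ.+ 2) ≤ᵣ f n +ᵣ fromℕ 3
  near n with ℕₚ.≤-total (b n 0) (a n 0)
  -- Here r ≤ 0 and truncated subtraction gives `Q n` = 0, possibly far above r; nonnegativity of f
  -- bounds the result instead.
  ... | inj₂ a≤b = ≤ᵣ-trans {fromℕ (Q n ℕ.+ 2)} {0ℝ +ᵣ fromℕ 3} {f n +ᵣ fromℕ 3}
    (subst (λ x → fromℕ (quot x (d n 0) ℕ.+ 2) ≤ᵣ 0ℝ +ᵣ fromℕ 3) (sym (ℕₚ.m≤n⇒m∸n≡0 a≤b))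
      (fromℚ-mono (ι-mono-≤ {2} {3} (s≤s (s≤s z≤n)))))
    (+ᵣ-mono-≤ᵣ {0ℝ} {f n} {fromℕ 3} {fromℕ 3} (0≤f n) (≤ᵣ-refl {fromℕ 3}))
  ... | inj₁ b≤a = ≤ᵣ-trans {fromℕ (Q n ℕ.+ 2)} {(fromℚ 1ℚ +ᵣ f n) +ᵣ fromℕ 2} {f n +ᵣ fromℕ 3}
    (≤ᵣ-trans {fromℕ (Q n ℕ.+ 2)} {fromℚ (r n) +ᵣ fromℕ 2} {(fromℚ 1ℚ +ᵣ f n) +ᵣ fromℕ 2}
      (≤ᵣ-pointwise {fromℕ (Q n ℕ.+ 2)} {fromℚ (r n) +ᵣ fromℕ 2} λ _ →
        subst (ℚ._≤ r n ℚ.+ ι 2) (sym (ι-+ (Q n) 2)) (ℚₚ.+-monoˡ-≤ (ι 2) (quot≤/ (d n 0) b≤a)))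
      (+ᵣ-mono-≤ᵣ {fromℚ (r n)} {fromℚ 1ℚ +ᵣ f n} {fromℕ 2} {fromℕ 2}
        (-ᵣ-≤ᵣ⇒≤ᵣ-+ᵣ {fromℚ (r n)} {f n} {fromℚ 1ℚ} (proj₁ (close n 0))) (≤ᵣ-refl {fromℕ 2})))
    (≤ᵣ-pointwise-≡ {(fromℚ 1ℚ +ᵣ f n) +ᵣ fromℕ 2} {f n +ᵣ fromℕ 3} λ k →
      trans (solve 3 (λ x y z → (x :+ y) :+ z := y :+ (x :+ z)) refl 1ℚ (approx (f n) k) (ι 2))
            (cong (approx (f n) k ℚ.+_) (sym (ι-+ 1 2))))
    where open +-*-Solver

-- Tails of the series and the choice of the threshold.

series-cauchy : ∀ {a} → SeriesConverges a → ∀ ε → 0ℚ ℚ.< ε →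
  ∃[ N ] (∀ m n → N ℕ.≤ m → N ℕ.≤ n → partialSum a n -ᵣ partialSum a m ≤ᵣ fromℚ ε)
series-cauchy {a} (L , conv) ε 0<ε = let (N , p) = conv (½ ℚ.* ε) (½-positive 0<ε) in
  N , λ m n N≤m N≤n →
    ≤ᵣ-trans {S n -ᵣ S m} {(S n -ᵣ L) +ᵣ (L -ᵣ S m)} {fromℚ ε}
      (≤ᵣ-pointwise-≡ {S n -ᵣ S m} {(S n -ᵣ L) +ᵣ (L -ᵣ S m)} λ k →
        solve 3 (λ x y l → x :+ con (ℚ.- 1ℚ) :* y := (x :+ con (ℚ.- 1ℚ) :* l) :+ (l :+ con (ℚ.- 1ℚ) :* y))
          refl (approx (S n) k) (approx (S m) k) (approx L k))
      (≤ᵣ-trans {(S n -ᵣ L) +ᵣ (L -ᵣ S m)} {fromℚ (½ ℚ.* ε) +ᵣ fromℚ (½ ℚ.* ε)} {fromℚ ε}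
        (+ᵣ-mono-≤ᵣ {S n -ᵣ L} {fromℚ (½ ℚ.* ε)} {L -ᵣ S m} {fromℚ (½ ℚ.* ε)}
          (proj₁ (p n N≤n)) (proj₂ (p m N≤m)))
        (≤ᵣ-pointwise-≡ {fromℚ (½ ℚ.* ε) +ᵣ fromℚ (½ ℚ.* ε)} {fromℚ ε} λ _ → ½+½ ε))
  where
  open +-*-Solver
  S = partialSum a

n<2^n : ∀ n → n ℕ.< 2 ^ n
n<2^n zero    = s≤s z≤n
n<2^n (suc n) = begin-strict
  suc n                 ≤⟨ n<2^n n ⟩
  2 ^ n                 <⟨ ℕₚ.m<m+n (2 ^ n) (ℕₚ.m<n⇒0<n (n<2^n n)) ⟩
  2 ^ n ℕ.+ 2 ^ n       ≡⟨ cong (2 ^ n ℕ.+_) (ℕₚ.+-identityʳ (2 ^ n)) ⟨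
  2 ^ suc n ∎
  where open ℕₚ.≤-Reasoning

-- For C > 0 this makes `potential` at most 1 / C from 2 C on. At 2 C it follows from C + 1 ≤ 2^C
-- squared; afterwards the right side doubles and the left at most doubles.
linear≤2^ : ∀ C d → (4 ℕ.* (d ℕ.+ (C ℕ.+ C)) ℕ.+ 10) ℕ.* C ℕ.≤ 2 ^ (3 ℕ.+ (d ℕ.+ (C ℕ.+ C)))
linear≤2^ C zero = begin
  (4 ℕ.* (C ℕ.+ C) ℕ.+ 10) ℕ.* C                              ≤⟨ ℕₚ.m≤m+n _ (6 ℕ.* C ℕ.+ 8) ⟩
  (4 ℕ.* (C ℕ.+ C) ℕ.+ 10) ℕ.* C ℕ.+ (6 ℕ.* C ℕ.+ 8)          ≡⟨ solve 1 (λ C →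
      (con 4 :* (C :+ C) :+ con 10) :* C :+ (con 6 :* C :+ con 8)
      := con 8 :* ((con 1 :+ C) :* (con 1 :+ C))) refl C ⟩
  8 ℕ.* (suc C ℕ.* suc C)                                     ≤⟨ ℕₚ.*-monoʳ-≤ 8 (ℕₚ.*-mono-≤ (n<2^n C) (n<2^n C)) ⟩
  8 ℕ.* (2 ^ C ℕ.* 2 ^ C)                                     ≡⟨ cong (8 ℕ.*_) (ℕₚ.^-distribˡ-+-* 2 C C) ⟨
  8 ℕ.* 2 ^ (C ℕ.+ C)                                         ≡⟨ ℕₚ.^-distribˡ-+-* 2 3 (C ℕ.+ C) ⟨
  2 ^ (3 ℕ.+ (C ℕ.+ C)) ∎
  where
  open ℕₚ.≤-Reasoning
  open ℕSolver.+-*-Solver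
linear≤2^ C (suc d) = begin
  (4 ℕ.* suc m ℕ.+ 10) ℕ.* C                                  ≤⟨ ℕₚ.m≤m+n _ ((4 ℕ.* m ℕ.+ 6) ℕ.* C) ⟩
  (4 ℕ.* suc m ℕ.+ 10) ℕ.* C ℕ.+ (4 ℕ.* m ℕ.+ 6) ℕ.* C        ≡⟨ solve 2 (λ m C →
      (con 4 :* (con 1 :+ m) :+ con 10) :* C :+ (con 4 :* m :+ con 6) :* C
      := con 2 :* ((con 4 :* m :+ con 10) :* C)) refl m C ⟩
  2 ℕ.* ((4 ℕ.* m ℕ.+ 10) ℕ.* C)                              ≤⟨ ℕₚ.*-monoʳ-≤ 2 (linear≤2^ C d) ⟩
  2 ^ (3 ℕ.+ suc m) ∎
  where
  open ℕₚ.≤-Reasoning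
  open ℕSolver.+-*-Solver
  m = d ℕ.+ (C ℕ.+ C)

2^-suc : ∀ k → 2^- k ≡ ι 2 ℚ.* 2^- suc k
2^-suc k = begin
  2^- k                                            ≡⟨ ℚₚ.*-identityʳ (2^- k) ⟨
  2^- k ℚ.* 1ℚ                                     ≡⟨ cong (2^- k ℚ.*_) (2^-inverse (suc k)) ⟨
  2^- k ℚ.* (ι (2 ℕ.* 2 ^ k) ℚ.* 2^- suc k)        ≡⟨ cong (λ x → 2^- k ℚ.* (x ℚ.* 2^- suc k)) (ι-* 2 (2 ^ k)) ⟩
  2^- k ℚ.* (ι 2 ℚ.* ι (2 ^ k) ℚ.* 2^- suc k)      ≡⟨ solve 4 (λ a b c d → a :* (b :* c :* d) := c :* a :* (b :* d))
                                                        refl (2^- k) (ι 2) (ι (2 ^ k)) (2^- suc k) ⟩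
  ι (2 ^ k) ℚ.* 2^- k ℚ.* (ι 2 ℚ.* 2^- suc k)      ≡⟨ cong (ℚ._* (ι 2 ℚ.* 2^- suc k)) (2^-inverse k) ⟩
  1ℚ ℚ.* (ι 2 ℚ.* 2^- suc k)                       ≡⟨ ℚₚ.*-identityˡ _ ⟩
  ι 2 ℚ.* 2^- suc k ∎
  where
  open ≡-Reasoning
  open +-*-Solver

module Quota {f : ℕ → ℝ} (F : NaturalBound f) (D : ℕ) where

  open NaturalBound F

  -- The summand 2 m pays for the header of a level-m program.
  demand : ℕ → ℕ
  demand m = bound (2 ^ (3 ℕ.+ m)) ℕ.+ 2 ℕ.* m

  -- potential m is the sum of (2k + 3) / 2^(3+k) over k ≥ m.
  potential : ℕ → ℚ
  potential m = ι (4 ℕ.* m ℕ.+ 10) ℚ.* 2^- (3 ℕ.+ m)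

  -- In the term split off, 2 m is the header charge in `demand` and 3 the slack in `near`. The
  -- coefficients 4 and 10 solve 4 m + 10 = (4 (m + 1) + 10) / 2 + 2 m + 3.
  potential-suc : ∀ m → potential m ≡ potential (suc m) ℚ.+ (ι (2 ℕ.* m) ℚ.+ ι 3) ℚ.* 2^- (3 ℕ.+ m)
  potential-suc m = begin
    ι (4 ℕ.* m ℕ.+ 10) ℚ.* 2^- (3 ℕ.+ m)
      ≡⟨ cong (ι (4 ℕ.* m ℕ.+ 10) ℚ.*_) (2^-suc (3 ℕ.+ m)) ⟩
    ι (4 ℕ.* m ℕ.+ 10) ℚ.* (ι 2 ℚ.* u)
      ≡⟨ ℚₚ.*-assoc (ι (4 ℕ.* m ℕ.+ 10)) (ι 2) u ⟨
    ι (4 ℕ.* m ℕ.+ 10) ℚ.* ι 2 ℚ.* u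
      ≡⟨ cong (ℚ._* u) (ι-* (4 ℕ.* m ℕ.+ 10) 2) ⟨
    ι ((4 ℕ.* m ℕ.+ 10) ℕ.* 2) ℚ.* u
      ≡⟨ cong (λ x → ι x ℚ.* u) (nat m) ⟩
    ι (4 ℕ.* suc m ℕ.+ 10 ℕ.+ (2 ℕ.* m ℕ.+ 3) ℕ.* 2) ℚ.* u
      ≡⟨ cong (ℚ._* u) (trans (ι-+ (4 ℕ.* suc m ℕ.+ 10) _)
           (cong (ι (4 ℕ.* suc m ℕ.+ 10) ℚ.+_) (trans (ι-* (2 ℕ.* m ℕ.+ 3) 2) (cong (ℚ._* ι 2) (ι-+ (2 ℕ.* m) 3))))) ⟩
    (ι (4 ℕ.* suc m ℕ.+ 10) ℚ.+ (ι (2 ℕ.* m) ℚ.+ ι 3) ℚ.* ι 2) ℚ.* u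
      ≡⟨ solve 4 (λ a b c u → (a :+ b :* c) :* u := a :* u :+ b :* (c :* u)) refl
           (ι (4 ℕ.* suc m ℕ.+ 10)) (ι (2 ℕ.* m) ℚ.+ ι 3) (ι 2) u ⟩
    potential (suc m) ℚ.+ (ι (2 ℕ.* m) ℚ.+ ι 3) ℚ.* (ι 2 ℚ.* u)
      ≡⟨ cong (λ x → potential (suc m) ℚ.+ (ι (2 ℕ.* m) ℚ.+ ι 3) ℚ.* x) (2^-suc (3 ℕ.+ m)) ⟨
    potential (suc m) ℚ.+ (ι (2 ℕ.* m) ℚ.+ ι 3) ℚ.* 2^- (3 ℕ.+ m) ∎
    where
    open ≡-Reasoning
    open +-*-Solver
    u = 2^- (4 ℕ.+ m)
    nat : ∀ m → (4 ℕ.* m ℕ.+ 10) ℕ.* 2 ≡ 4 ℕ.* suc m ℕ.+ 10 ℕ.+ (2 ℕ.* m ℕ.+ 3) ℕ.* 2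
    nat = S.solve 1 (λ m → (S.con 4 S.:* m S.:+ S.con 10) S.:* S.con 2 S.:=
      S.con 4 S.:* (S.con 1 S.:+ m) S.:+ S.con 10 S.:+ (S.con 2 S.:* m S.:+ S.con 3) S.:* S.con 2) refl
      where module S = ℕSolver.+-*-Solver

  module _ (m₀ : ℕ) where

    -- The weight 2^-(3+m), not 2^-m, matches the term of the series at 2^(3+m); the missing factor
    -- 8 returns in `offset-fits`.
    density : ℕ → ℚ
    density zero    = 0ℚ
    density (suc d) = density d ℚ.+ ι (demand (d ℕ.+ m₀)) ℚ.* 2^- (3 ℕ.+ (d ℕ.+ m₀))

    private
      S : ℕ → ℝ
      S = partialSum (λ m → (2^- m) ·ᵣ f (2 ^ m))

      tailSum : ℕ → ℝ
      tailSum d = (S (3 ℕ.+ (d ℕ.+ m₀)) -ᵣ S (3 ℕ.+ m₀)) +ᵣ fromℚ (potential m₀)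

    -- Adding the unspent potential on the left makes the induction telescope: each step pays for
    -- its header and rounding out of the potential and for f out of the series.
    density-bound : ∀ d → fromℚ (density d ℚ.+ potential (d ℕ.+ m₀)) ≤ᵣ tailSum d
    density-bound zero = ≤ᵣ-pointwise-≡ {fromℚ (0ℚ ℚ.+ potential m₀)} {tailSum 0} λ k →
      solve 2 (λ s p → con 0ℚ :+ p := (s :+ con (ℚ.- 1ℚ) :* s) :+ p) refl
        (approx (S (3 ℕ.+ m₀)) k) (potential m₀)
      where open +-*-Solver
    density-bound (suc d) =
      ≤ᵣ-trans {fromℚ (density (suc d) ℚ.+ potential (suc m))} {before} {tailSum (suc d)}
        (≤ᵣ-pointwise-≡ {fromℚ (density (suc d) ℚ.+ potential (suc m))} {before} λ _ → split)
        (≤ᵣ-trans {before} {after} {tailSum (suc d)}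
          (+ᵣ-mono-≤ᵣ {fromℚ (density d ℚ.+ potential m)} {tailSum d}
            {w ·ᵣ fromℕ b +ᵣ fromℚ (ℚ.- (w ℚ.* ι 3))} {w ·ᵣ (f n +ᵣ fromℕ 3) +ᵣ fromℚ (ℚ.- (w ℚ.* ι 3))}
            (density-bound d)
            (+ᵣ-mono-≤ᵣ {w ·ᵣ fromℕ b} {w ·ᵣ (f n +ᵣ fromℕ 3)}
              {fromℚ (ℚ.- (w ℚ.* ι 3))} {fromℚ (ℚ.- (w ℚ.* ι 3))}
              (·ᵣ-mono-≤ᵣ w {{2^-positive (3 ℕ.+ m)}} {fromℕ b} {f n +ᵣ fromℕ 3} (near n))
              (≤ᵣ-refl {fromℚ (ℚ.- (w ℚ.* ι 3))})))
          (≤ᵣ-pointwise-≡ {after} {tailSum (suc d)} λ k →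
            solve 6 (λ s t p w y c →
                ((s :+ con (ℚ.- 1ℚ) :* t) :+ p) :+ (w :* (y :+ c) :+ :- (w :* c))
                := ((s :+ w :* y) :+ con (ℚ.- 1ℚ) :* t) :+ p) refl
              (approx (S (3 ℕ.+ m)) k) (approx (S (3 ℕ.+ m₀)) k) (potential m₀) w (approx (f n) k) (ι 3)))
      where
      open +-*-Solver
      m = d ℕ.+ m₀
      n = 2 ^ (3 ℕ.+ m)
      b = bound n
      w = 2^- (3 ℕ.+ m)
      -- The step increases the left side by w (b - 3) and the right side by w (f n), and `near`
      -- compares the two.
      before after : ℝ
      before = fromℚ (density d ℚ.+ potential m) +ᵣ (w ·ᵣ fromℕ b +ᵣ fromℚ (ℚ.- (w ℚ.* ι 3)))
      after  = tailSum d +ᵣ (w ·ᵣ (f n +ᵣ fromℕ 3) +ᵣ fromℚ (ℚ.- (w ℚ.* ι 3)))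
      split : density d ℚ.+ ι (demand m) ℚ.* w ℚ.+ potential (suc m)
            ≡ density d ℚ.+ potential m ℚ.+ (w ℚ.* ι b ℚ.+ ℚ.- (w ℚ.* ι 3))
      split = begin
        density d ℚ.+ ι (demand m) ℚ.* w ℚ.+ potential (suc m)
          ≡⟨ cong (λ x → density d ℚ.+ x ℚ.* w ℚ.+ potential (suc m)) (ι-+ b (2 ℕ.* m)) ⟩
        density d ℚ.+ (ι b ℚ.+ ι (2 ℕ.* m)) ℚ.* w ℚ.+ potential (suc m)
          ≡⟨ solve 6 (λ v b t w p c → v :+ (b :+ t) :* w :+ p := v :+ (p :+ (t :+ c) :* w) :+ (w :* b :+ :- (w :* c)))
               refl (density d) (ι b) (ι (2 ℕ.* m)) w (potential (suc m)) (ι 3) ⟩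
        density d ℚ.+ (potential (suc m) ℚ.+ (ι (2 ℕ.* m) ℚ.+ ι 3) ℚ.* w) ℚ.+ (w ℚ.* ι b ℚ.+ ℚ.- (w ℚ.* ι 3))
          ≡⟨ cong (λ x → density d ℚ.+ x ℚ.+ (w ℚ.* ι b ℚ.+ ℚ.- (w ℚ.* ι 3))) (potential-suc m) ⟨
        density d ℚ.+ potential m ℚ.+ (w ℚ.* ι b ℚ.+ ℚ.- (w ℚ.* ι 3)) ∎
        where open ≡-Reasoning

    -- The first factor is the indicator of m₀ ≤ m.
    quota : ℕ → ℕ
    quota m = (1 ℕ.∸ (m₀ ℕ.∸ m)) ℕ.* (D ℕ.* demand m)

    quota-low : ∀ {m} → m ℕ.< m₀ → quota m ≡ 0
    quota-low {m} m<m₀ = cong (ℕ._* (D ℕ.* demand m)) (ℕₚ.m≤n⇒m∸n≡0 (ℕₚ.m<n⇒0<n∸m m<m₀))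

    quota-high : ∀ {m} → m₀ ℕ.≤ m → quota m ≡ D ℕ.* demand m
    quota-high {m} m₀≤m = trans (cong (λ x → (1 ℕ.∸ x) ℕ.* (D ℕ.* demand m)) (ℕₚ.m≤n⇒m∸n≡0 m₀≤m))
      (ℕₚ.*-identityˡ (D ℕ.* demand m))

    open Allocation quota

    offset-low : ∀ m → m ℕ.≤ m₀ → offset m ≡ 0
    offset-low zero    _    = refl
    offset-low (suc m) m<m₀ rewrite offset-low m (ℕₚ.<⇒≤ m<m₀) | quota-low m<m₀ = refl

    offset-density : ∀ d → ι (offset (d ℕ.+ m₀)) ≡ ι D ℚ.* density d ℚ.* ι (2 ^ (3 ℕ.+ (d ℕ.+ m₀)))
    offset-density zero rewrite offset-low m₀ ℕₚ.≤-refl =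
      solve 2 (λ d p → con 0ℚ := d :* con 0ℚ :* p) refl (ι D) (ι (2 ^ (3 ℕ.+ m₀)))
      where open +-*-Solver
    offset-density (suc d) = begin
      ι (2 ℕ.* (offset m ℕ.+ quota m))
        ≡⟨ trans (ι-* 2 (offset m ℕ.+ quota m)) (cong (ι 2 ℚ.*_) (ι-+ (offset m) (quota m))) ⟩
      ι 2 ℚ.* (ι (offset m) ℚ.+ ι (quota m))
        ≡⟨ cong₂ (λ x y → ι 2 ℚ.* (x ℚ.+ y)) (offset-density d)
             (trans (cong ι (quota-high (ℕₚ.m≤n+m m₀ d))) (ι-* D (demand m))) ⟩
      ι 2 ℚ.* (ι D ℚ.* density d ℚ.* p ℚ.+ ι D ℚ.* ι (demand m))
        ≡⟨ cong (λ x → ι 2 ℚ.* (ι D ℚ.* density d ℚ.* p ℚ.+ x))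
             (trans (sym (ℚₚ.*-identityʳ _)) (cong (ι D ℚ.* ι (demand m) ℚ.*_) (sym (2^-inverse (3 ℕ.+ m))))) ⟩
      ι 2 ℚ.* (ι D ℚ.* density d ℚ.* p ℚ.+ ι D ℚ.* ι (demand m) ℚ.* (p ℚ.* w))
        ≡⟨ solve 6 (λ t D v p h w → t :* (D :* v :* p :+ D :* h :* (p :* w)) := D :* (v :+ h :* w) :* (t :* p))
             refl (ι 2) (ι D) (density d) p (ι (demand m)) w ⟩
      ι D ℚ.* density (suc d) ℚ.* (ι 2 ℚ.* p)
        ≡⟨ cong (ι D ℚ.* density (suc d) ℚ.*_) (ι-* 2 (2 ^ (3 ℕ.+ m))) ⟨
      ι D ℚ.* density (suc d) ℚ.* ι (2 ^ (3 ℕ.+ suc m)) ∎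
      where
      open ≡-Reasoning
      open +-*-Solver
      m = d ℕ.+ m₀
      p = ι (2 ^ (3 ℕ.+ m))
      w = 2^- (3 ℕ.+ m)

    offset-fits : (∀ d → ι (D ℕ.* 8) ℚ.* density d ℚ.≤ 1ℚ) → ∀ d → offset (d ℕ.+ m₀) ℕ.≤ 2 ^ (d ℕ.+ m₀)
    offset-fits sparse d = ι-cancel-≤ (begin
      ι (offset m)                              ≡⟨ offset-density d ⟩
      ι D ℚ.* density d ℚ.* ι (2 ^ (3 ℕ.+ m))   ≡⟨ cong (ι D ℚ.* density d ℚ.*_)
                                                     (trans (cong ι (ℕₚ.^-distribˡ-+-* 2 3 m)) (ι-* 8 (2 ^ m))) ⟩
      ι D ℚ.* density d ℚ.* (ι 8 ℚ.* p)         ≡⟨ solve 4 (λ D v e p → D :* v :* (e :* p) := D :* e :* v :* p)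
                                                     refl (ι D) (density d) (ι 8) p ⟩
      ι D ℚ.* ι 8 ℚ.* density d ℚ.* p           ≡⟨ cong (λ x → x ℚ.* density d ℚ.* p) (ι-* D 8) ⟨
      ι (D ℕ.* 8) ℚ.* density d ℚ.* p           ≤⟨ ℚₚ.*-monoʳ-≤-nonNeg p {{ι-nonNegative (2 ^ m)}} (sparse d) ⟩
      1ℚ ℚ.* p                                  ≡⟨ ℚₚ.*-identityˡ p ⟩
      p ∎)
      where
      open ℚₚ.≤-Reasoning
      open +-*-Solver
      m = d ℕ.+ m₀
      p = ι (2 ^ m)

    quota-fits : (∀ d → ι (D ℕ.* 8) ℚ.* density d ℚ.≤ 1ℚ) → ∀ m → offset m ℕ.+ quota m ℕ.≤ 2 ^ m
    quota-fits sparse m with ℕₚ.≤-<-connex m₀ m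
    -- `offset (suc m)` is by definition twice the left side, so the bound on offsets one level up
    -- is twice the claim.
    ... | inj₁ m₀≤m = ℕₚ.*-cancelˡ-≤ 2
      (subst (λ k → offset (suc k) ℕ.≤ 2 ^ suc k) (ℕₚ.m∸n+n≡m m₀≤m) (offset-fits sparse (suc (m ℕ.∸ m₀))))
    ... | inj₂ m<m₀ rewrite offset-low m (ℕₚ.<⇒≤ m<m₀) | quota-low m<m₀ = z≤n

  eventually-sparse : SeriesConverges (λ m → (2^- m) ·ᵣ f (2 ^ m)) →
                      ∃[ m₀ ] (∀ d → ι (D ℕ.* 8) ℚ.* density m₀ d ℚ.≤ 1ℚ)
  eventually-sparse conv = m₀ , λ d → begin
      ι (D ℕ.* 8) ℚ.* density m₀ d         ≤⟨ ℚₚ.*-monoˡ-≤-nonNeg (ι (D ℕ.* 8)) {{ι-nonNegative (D ℕ.* 8)}} (density≤ d) ⟩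
      ι (D ℕ.* 8) ℚ.* (ε ℚ.+ ε)            ≡⟨ cong (λ x → ι (D ℕ.* 8) ℚ.* (x ℚ.+ x)) (sym (ℚₚ.*-identityˡ ε)) ⟩
      ι (D ℕ.* 8) ℚ.* (1ℚ ℚ.* ε ℚ.+ 1ℚ ℚ.* ε) ≡⟨ cong (ι (D ℕ.* 8) ℚ.*_) (ℚₚ.*-distribʳ-+ ε 1ℚ 1ℚ) ⟨
      ι (D ℕ.* 8) ℚ.* (ι 2 ℚ.* ε)          ≡⟨ ℚₚ.*-assoc (ι (D ℕ.* 8)) (ι 2) ε ⟨
      ι (D ℕ.* 8) ℚ.* ι 2 ℚ.* ε            ≡⟨ cong (ℚ._* ε) (ι-* (D ℕ.* 8) 2) ⟨
      ι e ℚ.* ε                            ≤⟨ *2^-≤ e 0 e (subst (ℕ._≤ 2 ^ e) (sym (ℕₚ.*-identityʳ e)) (ℕₚ.<⇒≤ (n<2^n e))) ⟩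
      1ℚ ∎
    where
    open ℚₚ.≤-Reasoning
    -- The tail of the series and the potential each get ε = 2^-e, and 8 D · 2 ε = e / 2^e ≤ 1.
    e = D ℕ.* 8 ℕ.* 2
    ε = 2^- e
    C = 2 ^ e
    tail-small = series-cauchy {λ m → (2^- m) ·ᵣ f (2 ^ m)} conv ε (ℚₚ.positive⁻¹ ε {{2^-positive e}})
    N = proj₁ tail-small
    -- Beyond N the series is within ε; the summand 2 C, with C = 1 / ε, brings the potential down
    -- to ε by `linear≤2^`.
    m₀ = N ℕ.+ (C ℕ.+ C)
    S = partialSum (λ m → (2^- m) ·ᵣ f (2 ^ m))

    density≤ : ∀ d → density m₀ d ℚ.≤ ε ℚ.+ ε
    density≤ d = begin
      density m₀ d                               ≡⟨ ℚₚ.+-identityʳ _ ⟨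
      density m₀ d ℚ.+ 0ℚ                        ≤⟨ ℚₚ.+-monoʳ-≤ (density m₀ d) potential≥0 ⟩
      density m₀ d ℚ.+ potential (d ℕ.+ m₀)      ≤⟨ fromℚ-cancel (≤ᵣ-trans
        {fromℚ (density m₀ d ℚ.+ potential (d ℕ.+ m₀))} {(S i -ᵣ S j) +ᵣ fromℚ (potential m₀)}
        {fromℚ (ε ℚ.+ potential m₀)} (density-bound m₀ d)
        (+ᵣ-mono-≤ᵣ {S i -ᵣ S j} {fromℚ ε} {fromℚ (potential m₀)} {fromℚ (potential m₀)}
          (proj₂ tail-small j i N≤j (ℕₚ.≤-trans N≤j (ℕₚ.+-monoʳ-≤ 3 (ℕₚ.m≤n+m m₀ d))))
          (≤ᵣ-refl {fromℚ (potential m₀)}))) ⟩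
      ε ℚ.+ potential m₀                         ≤⟨ ℚₚ.+-monoʳ-≤ ε (*2^-≤ (4 ℕ.* m₀ ℕ.+ 10) e (3 ℕ.+ m₀) (linear≤2^ C N)) ⟩
      ε ℚ.+ ε ∎
      where
      i = 3 ℕ.+ (d ℕ.+ m₀)
      j = 3 ℕ.+ m₀
      N≤j : N ℕ.≤ j
      N≤j = ℕₚ.≤-trans (ℕₚ.m≤m+n N (C ℕ.+ C)) (ℕₚ.m≤n+m m₀ 3)
      x = ι (4 ℕ.* (d ℕ.+ m₀) ℕ.+ 10)
      potential≥0 : 0ℚ ℚ.≤ potential (d ℕ.+ m₀)
      potential≥0 = subst (ℚ._≤ potential (d ℕ.+ m₀)) (ℚₚ.*-zeroʳ x)
        (ℚₚ.*-monoˡ-≤-nonNeg x {{ι-nonNegative (4 ℕ.* (d ℕ.+ m₀) ℕ.+ 10)}}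
          (ℚₚ.nonNegative⁻¹ (2^- i) {{2^-nonNegative i}}))

  quota-rec : ∀ m₀ → Recursive (uncurry₁ (quota m₀))
  quota-rec m₀ = lam₁ (app₂ *-rec (app₂ ∸-rec (const 1) (app₂ ∸-rec (const m₀) (var 0F)))
    (app₂ *-rec (const D) (app₂ +-rec (app₁ recursive (app₁ 2^-rec (app₂ +-rec (const 3) (var 0F))))
      (app₂ *-rec (const 2) (var 0F)))))

-- Tools for the complexity estimates.

archimedean : ∀ δ → 0ℚ < δ → ∃[ D ] (1ℚ ≤ ι D ℚ.* δ)
archimedean δ 0<δ = go δ (ℚ.positive 0<δ)
  where
  go : ∀ δ → ℚ.Positive δ → ∃[ D ] (1ℚ ≤ ι D ℚ.* δ)
  -- D is the denominator of δ, so D δ is its positive numerator.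
  go δ@(mkℚ +[1+ n ] d _) _ = suc d , ℚₚ.toℚᵘ-cancel-≤ (begin
    toℚᵘ 1ℚ                                    ≤⟨ ℚᵘ.*≤* (ℤ.+≤+ le) ⟩
    ℚᵘ.mkℚᵘ (+ suc d) 0 ℚᵘ.* toℚᵘ δ            ≃⟨ ℚᵘₚ.*-congʳ (toℚᵘ-/ (+ suc d) 0) ⟨
    toℚᵘ (ι (suc d)) ℚᵘ.* toℚᵘ δ               ≃⟨ ℚₚ.toℚᵘ-homo-* (ι (suc d)) δ ⟨
    toℚᵘ (ι (suc d) ℚ.* δ) ∎)
    where
    open ℚᵘₚ.≤-Reasoning
    le : 1 ℕ.* suc (d ℕ.+ 0) ℕ.≤ suc d ℕ.* suc n ℕ.* 1
    le = subst₂ ℕ._≤_ (sym (trans (ℕₚ.*-identityˡ _) (ℕₚ.+-identityʳ (suc d)))) (sym (ℕₚ.*-identityʳ _))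
           (ℕₚ.m≤m*n (suc d) (suc n))

x≤B⇒x-c≤k : ∀ {x B c k} → x ≤ᵣ fromℕ B → B ℕ.≤ k ℕ.+ c → x -ᵣ fromℕ c ≤ᵣ fromℕ k
x≤B⇒x-c≤k {x} {B} {c} {k} x≤B B≤ = ≤ᵣ-trans {x -ᵣ fromℕ c} {fromℕ B -ᵣ fromℕ c} {fromℕ k}
  (+ᵣ-mono-≤ᵣ {x} {fromℕ B} {(ℚ.- 1ℚ) ·ᵣ fromℕ c} {(ℚ.- 1ℚ) ·ᵣ fromℕ c} x≤B (≤ᵣ-refl {(ℚ.- 1ℚ) ·ᵣ fromℕ c}))
  (≤ᵣ-pointwise {fromℕ B -ᵣ fromℕ c} {fromℕ k} λ _ → begin
    ι B ℚ.+ ℚ.- 1ℚ ℚ.* ι c                 ≤⟨ ℚₚ.+-monoˡ-≤ (ℚ.- 1ℚ ℚ.* ι c) (ι-mono-≤ B≤) ⟩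
    ι (k ℕ.+ c) ℚ.+ ℚ.- 1ℚ ℚ.* ι c         ≡⟨ cong (ℚ._+ ℚ.- 1ℚ ℚ.* ι c) (ι-+ k c) ⟩
    ι k ℚ.+ ι c ℚ.+ ℚ.- 1ℚ ℚ.* ι c         ≡⟨ solve 2 (λ k c → k :+ c :+ con (ℚ.- 1ℚ) :* c := k) refl (ι k) (ι c) ⟩
    ι k ∎)
  where
  open ℚₚ.≤-Reasoning
  open +-*-Solver

Dh·δ-c≤k⇒h≤c+k : ∀ {δ D h c k} → 1ℚ ≤ ι D ℚ.* δ → ι (D ℕ.* h) ·ᵣ fromℚ δ -ᵣ fromℕ c ≤ᵣ fromℕ k → h ℕ.≤ c ℕ.+ k
Dh·δ-c≤k⇒h≤c+k {δ} {D} {h} {c} {k} 1≤Dδ le = ι-cancel-≤ (begin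
  ι h                                                  ≡⟨ ℚₚ.*-identityʳ (ι h) ⟨
  ι h ℚ.* 1ℚ                                           ≤⟨ ℚₚ.*-monoˡ-≤-nonNeg (ι h) {{ι-nonNegative h}} 1≤Dδ ⟩
  ι h ℚ.* (ι D ℚ.* δ)                                  ≡⟨ solve 4 (λ h D δ c → h :* (D :* δ) := c :+ (D :* h :* δ :+ con (ℚ.- 1ℚ) :* c))
                                                            refl (ι h) (ι D) δ (ι c) ⟩
  ι c ℚ.+ (ι D ℚ.* ι h ℚ.* δ ℚ.+ ℚ.- 1ℚ ℚ.* ι c)       ≡⟨ cong (λ x → ι c ℚ.+ (x ℚ.* δ ℚ.+ ℚ.- 1ℚ ℚ.* ι c)) (ι-* D h) ⟨
  ι c ℚ.+ (ι (D ℕ.* h) ℚ.* δ ℚ.+ ℚ.- 1ℚ ℚ.* ι c)       ≤⟨ ℚₚ.+-monoʳ-≤ (ι c) (fromℚ-cancel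
                                                            {ι (D ℕ.* h) ℚ.* δ ℚ.+ ℚ.- 1ℚ ℚ.* ι c} {ι k} le) ⟩
  ι c ℚ.+ ι k                                          ≡⟨ ι-+ c k ⟨
  ι (c ℕ.+ k) ∎)
  where
  open ℚₚ.≤-Reasoning
  open +-*-Solver

-- K U σ has a value only classically; this suffices for decidable conclusions.
¬¬K≤length : ∀ U σ L τ → length τ ℕ.≤ L → U ⟪ τ ⟫≃ σ → ¬ ¬ (∃[ k ] (K U σ k × k ℕ.≤ length τ))
¬¬K≤length U σ L τ τ≤L u none =
  none (length τ , ((τ , u , refl) , λ τ′ u′ → ℕₚ.≮⇒≥ λ τ′<τ → shorter L τ′ u′ τ′<τ τ≤L) , ℕₚ.≤-refl)
  where
  -- Descent with L as fuel: a program shorter than τ would, by induction, lead to a minimum that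
  -- `none` excludes, so τ itself is minimal, which `none` excludes as well.
  shorter : ∀ L τ′ → U ⟪ τ′ ⟫≃ σ → length τ′ ℕ.< length τ → length τ ℕ.≤ L → ⊥
  shorter zero    τ′ u′ τ′<τ τ≤0 = ℕₚ.<⇒≱ τ′<τ (ℕₚ.≤-trans τ≤0 z≤n)
  shorter (suc L) τ′ u′ τ′<τ τ≤L = ¬¬K≤length U σ L τ′ (ℕₚ.≤-pred (ℕₚ.≤-trans τ′<τ τ≤L)) u′
    λ (k , isK , k≤) → none (k , isK , ℕₚ.≤-trans k≤ (ℕₚ.<⇒≤ τ′<τ))

-- Downward search for the level that serves length n: 2^(2+m) guarantees an aligned block, and
-- 2^(3+m) is where `demand` evaluates the bound.
dyadicScale : ∀ a d {n} → 2 ^ (2 ℕ.+ a) ℕ.≤ n → n ℕ.< 2 ^ (2 ℕ.+ (d ℕ.+ a)) →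
              ∃[ m ] (a ℕ.≤ m × 2 ^ (2 ℕ.+ m) ℕ.≤ n × n ℕ.≤ 2 ^ (3 ℕ.+ m))
dyadicScale a zero    lo hi = contradiction lo (ℕₚ.<⇒≱ hi)
dyadicScale a (suc d) {n} lo hi with n ℕₚ.<? 2 ^ (2 ℕ.+ (d ℕ.+ a))
... | yes n< = dyadicScale a d lo n<
... | no  n≮ = d ℕ.+ a , ℕₚ.m≤n+m a d , ℕₚ.≮⇒≥ n≮ , ℕₚ.<⇒≤ hi

-- The reduction and its correctness.

module Reduction
  {U : Rec ⊥ 1} (U-universal : Universal U)
  {f : ℕ → ℝ} (f-mono : ∀ {m n} → m ℕ.≤ n → f m ≤ᵣ f n) (F : NaturalBound f)
  {δ : ℚ} {D : ℕ} (1≤Dδ : 1ℚ ≤ ι D ℚ.* δ)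
  {m₀ : ℕ} (sparse : ∀ d → ι (D ℕ.* 8) ℚ.* Quota.density F D m₀ d ≤ 1ℚ)
  where

  open Universal U-universal
  open NaturalBound F
  open Quota F D

  g : ℕ → ℕ
  g = quota m₀
  open Allocation g
  open Machine U g (quota-rec m₀)

  fits : ∀ m → offset m ℕ.+ g m ℕ.≤ 2 ^ m
  fits = quota-fits m₀ sparse

  simulation = simulates machine (machine-prefixFree prefixFree)

  ρ : List Bool
  ρ = proj₁ simulation

  module _ {X : ℕ → Bool} {c : ℕ}
    (complex : ∀ n → K[ U ] (X ↾ n) ≥ (ι n ·ᵣ fromℚ δ -ᵣ fromℕ c)) where

    demand≤ : ∀ β p {start n} q → m₀ ℕ.≤ length β → start ℕ.+ code β ≡ q ℕ.* 2 ^ length β →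
      2 ^ (2 ℕ.+ length β) ℕ.≤ n → U ⟪ p ⟫≃ applyUpTo (λ j → X (owner (start ℕ.+ j))) n →
      demand (length β) ℕ.≤ c ℕ.+ length (ρ ++ header β ++ p)
    demand≤ β p q m₀≤ aligned long u = decidable-stable (demand (length β) ℕₚ.≤? (c ℕ.+ length simulated)) λ ¬le →
      ¬¬K≤length U (X ↾ g (length β)) (length simulated) simulated ℕₚ.≤-refl run λ (k , isK , k≤) →
        ¬le (ℕₚ.≤-trans
          (Dh·δ-c≤k⇒h≤c+k {δ} {D} {demand (length β)} {c} {k} 1≤Dδ
            (subst (λ x → ι x ·ᵣ fromℚ δ -ᵣ fromℕ c ≤ᵣ fromℕ k) (quota-high m₀ m₀≤)
              (complex (g (length β)) k isK)))
          (ℕₚ.+-monoʳ-≤ c k≤))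
      where
      simulated = ρ ++ header β ++ p
      run : U ⟪ simulated ⟫≃ (X ↾ g (length β))
      run = proj₂ (proj₂ simulation (header β ++ p) (X ↾ g (length β)))
        (machine-extracts X β p q (fits (length β)) aligned long u)

    -- With β chosen by `align`, the 2 m in `demand` cancels the header length up to one bit, so the
    -- remaining constant does not depend on m.
    bound≤ : ∀ m p {start n} → m₀ ℕ.≤ m → 2 ^ (2 ℕ.+ m) ℕ.≤ n →
      U ⟪ p ⟫≃ applyUpTo (λ j → X (owner (start ℕ.+ j))) n →
      bound (2 ^ (3 ℕ.+ m)) ℕ.≤ length p ℕ.+ suc (c ℕ.+ length ρ)
    bound≤ m p {start} m₀≤m long u with align m start
    ... | β , refl , q , aligned = ℕₚ.+-cancelʳ-≤ (2 ℕ.* length β) _ _ (begin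
      demand (length β)
        ≤⟨ demand≤ β p q m₀≤m aligned long u ⟩
      c ℕ.+ length (ρ ++ header β ++ p)
        ≡⟨ cong (c ℕ.+_) (trans (length-++ ρ) (cong (length ρ ℕ.+_)
             (trans (length-++ (header β)) (cong (ℕ._+ length p) (length-header β))))) ⟩
      c ℕ.+ (length ρ ℕ.+ (suc (2 ℕ.* length β) ℕ.+ length p))
        ≡⟨ solve 4 (λ c r m p → c :+ (r :+ (con 1 :+ m :+ p)) := p :+ (con 1 :+ (c :+ r)) :+ m) refl
             c (length ρ) (2 ℕ.* length β) (length p) ⟩
      length p ℕ.+ suc (c ℕ.+ length ρ) ℕ.+ 2 ℕ.* length β ∎)
      where
      open ℕₚ.≤-Reasoning
      open ℕSolver.+-*-Solver

    -- The first summand alone settles substrings too short for level m₀, the second those that some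
    -- level serves; the sum covers both.
    deficit : ℕ
    deficit = bound (2 ^ (2 ℕ.+ m₀)) ℕ.+ suc (c ℕ.+ length ρ)

    f-deficit≤ : ∀ {n N k} → n ℕ.≤ N → bound N ℕ.≤ k ℕ.+ deficit → f n -ᵣ fromℕ deficit ≤ᵣ fromℕ k
    f-deficit≤ {n} {N} {k} n≤N = x≤B⇒x-c≤k {f n} {bound N} {deficit} {k}
      (≤ᵣ-trans {f n} {f N} {fromℕ (bound N)} (f-mono n≤N) (above N))

    short-substring : ∀ n k → n ℕ.≤ 2 ^ (2 ℕ.+ m₀) → f n -ᵣ fromℕ deficit ≤ᵣ fromℕ k
    short-substring n k short = f-deficit≤ {n} {2 ^ (2 ℕ.+ m₀)} {k} short
      (ℕₚ.≤-trans (ℕₚ.m≤m+n (bound (2 ^ (2 ℕ.+ m₀))) (suc (c ℕ.+ length ρ))) (ℕₚ.m≤n+m deficit k))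

    long-substring : ∀ n start p → 2 ^ (2 ℕ.+ m₀) ℕ.≤ n →
      U ⟪ p ⟫≃ applyUpTo (λ j → X (owner (start ℕ.+ j))) n → f n -ᵣ fromℕ deficit ≤ᵣ fromℕ (length p)
    -- Any starting point above the scale of n will do for the search; n steps suffice because n <
    -- 2^n.
    long-substring n start p long u = at-scale (dyadicScale m₀ n long
        (ℕₚ.<-≤-trans (n<2^n n)
          (ℕₚ.^-monoʳ-≤ 2 (ℕₚ.≤-trans (ℕₚ.m≤m+n n m₀) (ℕₚ.m≤n+m (n ℕ.+ m₀) 2)))))
      where
      at-scale : ∃[ m ] (m₀ ℕ.≤ m × 2 ^ (2 ℕ.+ m) ℕ.≤ n × n ℕ.≤ 2 ^ (3 ℕ.+ m)) →
                 f n -ᵣ fromℕ deficit ≤ᵣ fromℕ (length p)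
      at-scale (m , m₀≤m , lo , hi) = f-deficit≤ {n} {2 ^ (3 ℕ.+ m)} {length p} hi
        (ℕₚ.≤-trans (bound≤ m p {start} {n} m₀≤m lo u)
          (ℕₚ.+-monoʳ-≤ (length p) (ℕₚ.m≤n+m (suc (c ℕ.+ length ρ)) (bound (2 ^ (2 ℕ.+ m₀))))))

    shiftComplex : SC U f (X ∘ owner)
    shiftComplex = deficit , λ { τ (start , τ≡) k ((p , u , refl) , _) → substring τ start τ≡ p u }
      where
      substring : ∀ τ start → τ ≡ applyUpTo (λ j → X (owner (start ℕ.+ j))) (length τ) →
                  ∀ p → U ⟪ p ⟫≃ τ → f (length τ) -ᵣ fromℕ deficit ≤ᵣ fromℕ (length p)
      substring τ start τ≡ p u =
        [ (λ short → short-substring (length τ) (length p) (ℕₚ.<⇒≤ short))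
        , (λ long  → long-substring (length τ) start p long (subst (U ⟪ p ⟫≃_) τ≡ u))
        ]′ (ℕₚ.<-≤-connex (length τ) (2 ^ (2 ℕ.+ m₀)))

  owner-recursive : Recursive (uncurry₁ owner)
  owner-recursive = owner-rec (quota-rec m₀)

  -- Each output bit costs one oracle query, at `owner n`.
  reduction : ⌜ SC U f ⌝ ≤ₛ ⌜ COMPLEX U (fromℚ δ) ⌝
  reduction = comp (oracle tt) (relativize (program owner-recursive) ∷ []) ,
    λ { G (X , (c , complex) , G≡) →
        G ∘ owner , (X ∘ owner , shiftComplex {X} {c} complex , G≡ ∘ owner) ,
        λ n → ⇓comp (relativize-⇓ _ (correct owner-recursive (n ∷ [])) ∷ []) (⇓oracle tt) }

mainTheorem14 : (U : Rec ⊥ 1) → Universal U →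
    (f : ℕ → ℝ) → (∀ n → 0ℝ ≤ᵣ f n) →
    OrderFunction f → SubIdentical f →
    SeriesConverges (λ m → (2^- m) ·ᵣ f (2 ^ m)) →
    (δ : ℚ) → 0ℚ < δ → δ ≤ 1ℚ →
    ⌜ SC U f ⌝ ≤ₛ ⌜ COMPLEX U (fromℚ δ) ⌝
mainTheorem14 U U-universal f 0≤f f-order _ converges δ 0<δ _ =
  choose (naturalBound 0≤f computable) (archimedean δ 0<δ)
  where
  open OrderFunction f-order
  choose : NaturalBound f → ∃[ D ] (1ℚ ≤ ι D ℚ.* δ) → ⌜ SC U f ⌝ ≤ₛ ⌜ COMPLEX U (fromℚ δ) ⌝
  choose F (D , 1≤Dδ) =
    let (m₀ , sparse) = Quota.eventually-sparse F D converges
    in Reduction.reduction U-universal {f} nondecreasing F {δ} {D} 1≤Dδ {m₀} sparse
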